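{- Let $r\ge 2$, $k \ge 1$ and $n \ge sk$ be integers. Write the prime factorization of $r$ as $r = 2^{\alpha_0}\cdot p_1^{\alpha_1} \cdots p_t^{\alpha_t}$, where $p_1,\dots,p_t$ are pairwise distinct odd primes and $\alpha_i \in \mathbb{Z}_{\ge 0}$, and let $s$ be an integer with $2 \le s \le 2^{\alpha_0}\cdot (p_1-1)^{\alpha_1} \cdots (p_t-1)^{\alpha_t}$. Then for every coloring of the $k$-element subsets of $[n]=\{1,\dots,n\}$ with fewer than $\left\lceil \frac{(s-1)n-r(k-1)}{r-1} \right\rceil$ colors, there exist $k$-element subsets $A_1,\dots,A_r \subseteq [n]$ (not necessarily distinct) that all receive the same color and such that $A_{i_1}\cap \dots \cap A_{i_s} = \emptyset$ for all pairwise distinct indices $i_1,\dots,i_s \in [r]$. Equivalently, at least $\left\lceil \frac{(s-1)n-r(k-1)}{r-1} \right\rceil$ colors are required in any coloring of the $k$-subsets of $[n]$ which ensures that among any $r$ (not necessarily distinct) same-colored $k$-subsets, some $s$ of them (taken at distinct positions) have a common element.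
   Context: Here "some $s$ of them intersect" means that all $s$ sets share a common element (not merely pairwise intersections); the $r$ sets form a sequence in which repetitions are allowed, and choosing $s$ of them means choosing $s$ distinct positions in the sequence. -}

module Defs where

open import Data.Nat using (ℕ; zero; suc; _+_; _*_; _∸_; _^_; _≡ᵇ_)
open import Data.Nat.DivMod using (_/_; _%_)
open import Data.Nat.Primality using (Prime)
open import Data.Product using (_×_; _,_; proj₁; ∃-syntax; Σ-syntax)
open import Data.List using (List; map)
open import Data.Nat.ListAction using (product)
open import Data.List.Relation.Unary.All using (All)
open import Data.List.Relation.Unary.AllPairs using (AllPairs)
open import Data.Fin using (Fin)
open import Data.Fin.Subset using (Subset; _∈_; _∉_; ∣_∣)
open import Function.Definitions using (Injective)
open import Relation.Binary.PropositionalEquality using (_≡_; _≢_)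

-- ⌈ a / d ⌉ for d ≥ 1 (value 0 for d = 0, never used since r ≥ 2)
ceilDiv : ℕ → ℕ → ℕ
ceilDiv a zero = 0
ceilDiv a (suc d) = (a + d) / suc d

-- ⌈ ((s-1)n - r(k-1)) / (r-1) ⌉, truncated at 0 (if the real numerator is
-- ≤ 0 the real ceiling is ≤ 0 and "fewer than that many colours" is impossible
-- either way).
colorBound : ℕ → ℕ → ℕ → ℕ → ℕ
colorBound r s n k = ceilDiv ((s ∸ 1) * n ∸ r * (k ∸ 1)) (r ∸ 1)

OddPrimeFactorList : List (ℕ × ℕ) → Set
OddPrimeFactorList ps =
  All (λ pa → Prime (proj₁ pa) × proj₁ pa % 2 ≡ 1) ps
  × AllPairs (λ pa qb → proj₁ pa ≢ proj₁ qb) ps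

primePowerProduct : List (ℕ × ℕ) → ℕ
primePowerProduct ps = product (map (λ { (p , α) → p ^ α }) ps)

shiftedPowerProduct : List (ℕ × ℕ) → ℕ
shiftedPowerProduct ps = product (map (λ { (p , α) → (p ∸ 1) ^ α }) ps)

IsKSubset : ∀ {n} → ℕ → Subset n → Set
IsKSubset k A = ∣ A ∣ ≡ k

NoSWiseIntersection : ∀ {n r} → (s : ℕ) → (Fin r → Subset n) → Set
NoSWiseIntersection {n} {r} s A =
  (ι : Fin s → Fin r) → Injective _≡_ _≡_ ι →
  (x : Fin n) → ∃[ j ] (x ∉ A (ι j))

{-# OPTIONS --safe #-}
-- Replace k-sets by vectors in ℕⁿ below a cap u, and the bound s − 1 on the multiplicity of a point by an
-- arbitrary weight w ≤ r u. In this form the statement is multiplicative in r: to pass from a and b to a b,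
-- colour a vector V below a u, of the size needed for the case a with weight V, by the colour found
-- there, and apply the case b to these vectors. So r may be assumed to be a prime p.
--
-- For a prime p, write w = ρ + p b with ρ < p. The vector b can be put into all p vectors, so one is
-- left with sets and weights ρ < p. Families of p sets are subsets of [n] × ℤ/p. Without a solution, such a
-- family gets an equivariant sign in ℤ/p: for the largest colour occurring inside its members, the mean of
-- the indices of the members containing a set of that colour (or, if no colour occurs, the mean of the first
-- nonempty row). An unchanged colour and index set means an unchanged sign, so a flag of families all of
-- whose consecutive signs differ has at most p(k−1) + m(p−1) members. But a ℤ/p-version of Tucker's lemma
-- gives such a flag with ∑ ρ members: the composite of the maps from the periodic resolution of ℤ/p to the
-- subdivided tuples, to the bar resolution and back to the periodic resolution has degree 1 modulo p.
module Submission where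

open import Defs
open import Data.Bool using (true; false; if_then_else_)
open import Data.Empty using (⊥; ⊥-elim)
open import Data.Fin using (Fin; zero; suc; toℕ; fromℕ; inject₁; punchIn; punchOut)
import Data.Fin.Properties as Fin
open import Data.Fin.Relation.Unary.Top using (View; view; ‵fromℕ; ‵inject₁; view-fromℕ; view-inject₁)
open import Data.Fin.Subset using (Subset; inside; outside; ∣_∣) renaming (_∈_ to _∈ˢ_; _⊆_ to _⊆ˢ_)
open import Data.Fin.Subset.Properties using (anySubset?; _∈?_; _⊆?_; drop-there)
open import Data.List as List using (List; []; _∷_; _++_; map; length; allFin; replicate)
open import Data.List.Membership.Propositional using (_∈_)
open import Data.List.Membership.Propositional.Properties using (∈-map⁺; ∈-map⁻; ∈-allFin; ∈-lookup)
import Data.List.Membership.DecPropositional as DecMembership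
open import Data.List.Properties using (map-∘; map-++; length-++; length-map; length-replicate; length-tabulate)
open import Data.List.Relation.Binary.Sublist.Propositional using (_⊆_; []; _∷ʳ_; _∷_; ⊆-refl) renaming (lookup to ⊆-lookup)
open import Data.List.Relation.Unary.All as All using (All; []; _∷_)
import Data.List.Relation.Unary.All.Properties as All
open import Data.List.Relation.Unary.Any using (here; there)
open import Data.Product using (_×_; _,_; proj₁; proj₂; map₂; ∃; ∃-syntax; Σ-syntax)
open import Data.Product.Properties using (≡-dec)
open import Data.Sum using (_⊎_; inj₁; inj₂)
open import Data.Vec using (Vec; []; _∷_; here; there; tabulate; lookup)
open import Data.Vec.Properties using (lookup⇒[]=; []=⇒lookup; lookup∘tabulate; tabulate-cong)
open import Function using (_∘_; id; mk⇔)
open import Function.Definitions using (Injective)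
open import Relation.Binary.PropositionalEquality
open import Relation.Nullary using (Dec; yes; no; does; ¬_)
open import Relation.Nullary.Decidable using (_×-dec_; map′; dec-true; does-⇔; ¬?; decidable-stable)
open import Relation.Unary using (Decidable)

-- Cochains on tuples, their coboundary, and pullback along subdivision

module Cochains where

  open import Data.Nat as ℕ using (ℕ; zero; suc; _<ᵇ_; z≤n; s≤s)
  import Data.Nat.Properties as ℕ
  open import Data.Integer using (ℤ; 0ℤ; 1ℤ; -1ℤ; +_; _+_; _*_) renaming (∣_∣ to ∣_∣ᶻ)
  open import Data.Integer.Tactic.RingSolver using (solve-∀)
  import Data.Integer.Properties as ℤ

  private variable
    A B : Set

  -- All degrees at once: a list of length n + 1 is an n-simplex, possibly degenerate, and `[]` is
  -- the augmentation simplex of degree -1.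
  Cochain : Set → Set
  Cochain A = List A → ℤ

  -- The recursion unfolds to the alternating sum over the deletions of one entry. Subtraction is
  -- written with `-1ℤ *` so that one linearity lemma serves sums and differences.
  d : Cochain A → Cochain A
  d f [] = 0ℤ
  d f (x ∷ u) = f u + -1ℤ * d (λ l → f (x ∷ l)) u

  d-cong : ∀ {f g : Cochain A} → f ≗ g → d f ≗ d g
  d-cong e [] = refl
  d-cong e (x ∷ u) = cong₂ (λ a b → a + -1ℤ * b) (e u) (d-cong (λ l → e (x ∷ l)) u)

  d-linear : ∀ c (f g : Cochain A) u → d (λ l → f l + c * g l) u ≡ d f u + c * d g u
  d-linear c f g [] = sym (trans (ℤ.+-identityˡ _) (ℤ.*-zeroʳ c))
  d-linear c f g (x ∷ u)
    rewrite d-linear c (λ l → f (x ∷ l)) (λ l → g (x ∷ l)) u = lemma c (f u) (g u) _ _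
    where
    lemma : ∀ c a b x y → (a + c * b) + -1ℤ * (x + c * y) ≡ (a + -1ℤ * x) + c * (b + -1ℤ * y)
    lemma = solve-∀

  d-vanish : ∀ (f : Cochain A) u → (∀ v → v ⊆ u → f v ≡ 0ℤ) → d f u ≡ 0ℤ
  d-vanish f [] z = refl
  d-vanish f (x ∷ u) z
    rewrite z u (x ∷ʳ ⊆-refl) | d-vanish (λ l → f (x ∷ l)) u (λ v s → z (x ∷ v) (refl ∷ s)) = refl

  d-scale : ∀ c (f : Cochain A) u → d (λ l → c * f l) u ≡ c * d f u
  d-scale c f u = begin
    d (λ l → c * f l) u         ≡⟨ d-cong (λ l → sym (ℤ.+-identityˡ _)) u ⟩
    d (λ l → 0ℤ + c * f l) u    ≡⟨ d-linear c (λ _ → 0ℤ) f u ⟩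
    d (λ _ → 0ℤ) u + c * d f u  ≡⟨ cong (_+ c * d f u) (d-vanish (λ _ → 0ℤ) u (λ _ _ → refl)) ⟩
    0ℤ + c * d f u              ≡⟨ ℤ.+-identityˡ _ ⟩
    c * d f u                   ∎
    where open ≡-Reasoning

  d∘d : ∀ (f : Cochain A) u → d (d f) u ≡ 0ℤ
  d∘d f [] = refl
  d∘d f (x ∷ u)
    rewrite d-linear -1ℤ f (d (λ l → f (x ∷ l))) u | d∘d (λ l → f (x ∷ l)) u = lemma (d f u)
    where
    lemma : ∀ a → a + -1ℤ * (a + -1ℤ * 0ℤ) ≡ 0ℤ
    lemma = solve-∀

  d-map : ∀ (h : A → B) (f : Cochain B) u → d (f ∘ map h) u ≡ d f (map h u)
  d-map h f [] = refl
  d-map h f (x ∷ u) = cong (λ a → f (map h u) + -1ℤ * a) (d-map h (λ l → f (h x ∷ l)) u)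

  -- The pullback of cochains along barycentric subdivision followed by σ; flags are listed from the top down.
  module Subdivision {V G : Set} (σ : List V → G) where

    S : ℕ → Cochain G → Cochain V
    S zero κ u = κ []
    S (suc n) κ u = d (S n (λ l → κ (σ u ∷ l))) u

    S-cong : ∀ n {κ κ′} → κ ≗ κ′ → S n κ ≗ S n κ′
    S-cong zero e u = e []
    S-cong (suc n) e u = d-cong (S-cong n (λ l → e (σ u ∷ l))) u

    S-linear : ∀ n c κ κ′ u → S n (λ l → κ l + c * κ′ l) u ≡ S n κ u + c * S n κ′ u
    S-linear zero c κ κ′ u = refl
    S-linear (suc n) c κ κ′ u = trans (d-cong (S-linear n c _ _) u) (d-linear c _ _ u)

    S-zero : ∀ n κ → (∀ l → κ l ≡ 0ℤ) → ∀ u → S n κ u ≡ 0ℤ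
    S-zero zero κ z u = z []
    S-zero (suc n) κ z u = d-vanish _ u (λ v _ → S-zero n _ (λ l → z (σ u ∷ l)) v)

    -- Once the head `σ u` is split off, the unwanted part of `d κ` is the coboundary of a
    -- subdivided coboundary. `d-S-d` kills it, by `S-d` one degree lower and `d∘d`.
    S-d : ∀ n κ u → S (suc n) (d κ) u ≡ d (S n κ) u
    d-S-d : ∀ n κ u → d (S n (d κ)) u ≡ 0ℤ

    S-d n κ u = begin
      d (S n (λ l → κ l + -1ℤ * d κ′ l)) u         ≡⟨ d-cong (S-linear n -1ℤ κ (d κ′)) u ⟩
      d (λ v → S n κ v + -1ℤ * S n (d κ′) v) u     ≡⟨ d-linear -1ℤ (S n κ) (S n (d κ′)) u ⟩
      d (S n κ) u + -1ℤ * d (S n (d κ′)) u         ≡⟨ cong (λ a → d (S n κ) u + -1ℤ * a) (d-S-d n κ′ u) ⟩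
      d (S n κ) u + -1ℤ * 0ℤ                       ≡⟨ ℤ.+-identityʳ _ ⟩
      d (S n κ) u                                  ∎
      where
      open ≡-Reasoning
      κ′ = λ l → κ (σ u ∷ l)

    d-S-d zero κ u = d-vanish _ u (λ _ _ → refl)
    d-S-d (suc n) κ u = trans (d-cong (S-d n κ) u) (d∘d (S n κ) u)

    module _ (τ : V → V) (t : G → G) (σ-equivariant : ∀ x u → σ (map τ (x ∷ u)) ≡ t (σ (x ∷ u))) where

      S-equivariant : ∀ n κ u → S n κ (map τ u) ≡ S n (κ ∘ map t) u
      S-equivariant zero κ u = refl
      -- Equivariance of `σ` is assumed for nonempty lists; on `[]` the coboundary is zero by
      -- definition.
      S-equivariant (suc n) κ [] = refl
      S-equivariant (suc n) κ u@(x ∷ u′) = begin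
        d (S n (λ l → κ (σ (map τ u) ∷ l))) (map τ u)        ≡⟨ d-map τ (S n (λ l → κ (σ (map τ u) ∷ l))) u ⟨
        d (λ v → S n (λ l → κ (σ (map τ u) ∷ l)) (map τ v)) u ≡⟨ d-cong (S-equivariant n _) u ⟩
        d (S n (λ l → κ (σ (map τ u) ∷ map t l))) u           ≡⟨ cong (λ g → d (S n (λ l → κ (g ∷ map t l))) u) (σ-equivariant x u′) ⟩
        d (S n (λ l → κ (t (σ u) ∷ map t l))) u               ∎
        where open ≡-Reasoning

  -- The periodic resolution of the cyclic group

  module Periodic (p : ℕ) where

    Δ : (A → A) → Cochain A → Cochain A
    Δ h f u = f (map h u) + -1ℤ * f u

    orbitSum : ℕ → (A → A) → Cochain A → Cochain A
    orbitSum zero h f u = 0ℤ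
    orbitSum (suc j) h f u = f u + 1ℤ * orbitSum j h (f ∘ map h) u

    Operator : Set₁
    Operator = ∀ {A} → (A → A) → Cochain A → Cochain A

    norm : Operator
    norm = orbitSum p

    -- The differentials T - 1 and 1 + T + ... + T^(p-1) of the periodic resolution, in turn.
    alternating : ℕ → Operator
    alternating zero = Δ
    alternating (suc zero) = norm
    alternating (suc (suc n)) = alternating n

    -- The same differentials shifted by one: the bottom one is the augmentation onto the empty
    -- tuple.
    θ : ℕ → Operator
    θ zero h f = f
    θ (suc n) = alternating n

    orbitSum-cong : ∀ j (h : A → A) {f g : Cochain A} → f ≗ g → orbitSum j h f ≗ orbitSum j h g
    orbitSum-cong zero h e u = refl
    orbitSum-cong (suc j) h e u = cong₂ (λ a b → a + 1ℤ * b) (e u) (orbitSum-cong j h (e ∘ map h) u)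

    alternating-cong : ∀ n (h : A → A) {f g : Cochain A} → f ≗ g → alternating n h f ≗ alternating n h g
    alternating-cong zero h e u = cong₂ (λ a b → a + -1ℤ * b) (e (map h u)) (e u)
    alternating-cong (suc zero) h e = orbitSum-cong p h e
    alternating-cong (suc (suc n)) h e = alternating-cong n h e

    θ-cong : ∀ n (h : A → A) {f g : Cochain A} → f ≗ g → θ n h f ≗ θ n h g
    θ-cong zero h e = e
    θ-cong (suc n) h e = alternating-cong n h e

    orbitSum-linear : ∀ j (h : A → A) c (f g : Cochain A) u →
      orbitSum j h (λ l → f l + c * g l) u ≡ orbitSum j h f u + c * orbitSum j h g u
    orbitSum-linear zero h c f g u = sym (trans (ℤ.+-identityˡ _) (ℤ.*-zeroʳ c))
    orbitSum-linear (suc j) h c f g u rewrite orbitSum-linear j h c (f ∘ map h) (g ∘ map h) u =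
      lemma c (f u) (g u) _ _
      where
      lemma : ∀ c a b x y → (a + c * b) + 1ℤ * (x + c * y) ≡ (a + 1ℤ * x) + c * (b + 1ℤ * y)
      lemma = solve-∀

    alternating-linear : ∀ n (h : A → A) c (f g : Cochain A) u →
      alternating n h (λ l → f l + c * g l) u ≡ alternating n h f u + c * alternating n h g u
    alternating-linear zero h c f g u = lemma c (f (map h u)) (g (map h u)) (f u) (g u)
      where
      lemma : ∀ c a b x y → (a + c * b) + -1ℤ * (x + c * y) ≡ (a + -1ℤ * x) + c * (b + -1ℤ * y)
      lemma = solve-∀
    alternating-linear (suc zero) h = orbitSum-linear p h
    alternating-linear (suc (suc n)) h = alternating-linear n h

    θ-linear : ∀ n (h : A → A) c (f g : Cochain A) u →
      θ n h (λ l → f l + c * g l) u ≡ θ n h f u + c * θ n h g u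
    θ-linear zero h c f g u = refl
    θ-linear (suc n) h = alternating-linear n h

    orbitSum-d : ∀ j (h : A → A) (f : Cochain A) u → orbitSum j h (d f) u ≡ d (orbitSum j h f) u
    orbitSum-d zero h f u = sym (d-vanish _ u (λ _ _ → refl))
    orbitSum-d (suc j) h f u = begin
      d f u + 1ℤ * orbitSum j h (d f ∘ map h) u
        ≡⟨ cong (λ a → d f u + 1ℤ * a) (orbitSum-cong j h (λ v → sym (d-map h f v)) u) ⟩
      d f u + 1ℤ * orbitSum j h (d (f ∘ map h)) u
        ≡⟨ cong (λ a → d f u + 1ℤ * a) (orbitSum-d j h (f ∘ map h) u) ⟩
      d f u + 1ℤ * d (orbitSum j h (f ∘ map h)) u
        ≡⟨ d-linear 1ℤ f (orbitSum j h (f ∘ map h)) u ⟨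
      d (orbitSum (suc j) h f) u ∎
      where open ≡-Reasoning

    alternating-d : ∀ n (h : A → A) (f : Cochain A) u → alternating n h (d f) u ≡ d (alternating n h f) u
    alternating-d zero h f u =
      trans (cong (_+ -1ℤ * d f u) (sym (d-map h f u))) (sym (d-linear -1ℤ (f ∘ map h) f u))
    alternating-d (suc zero) h = orbitSum-d p h
    alternating-d (suc (suc n)) h = alternating-d n h

    θ-d : ∀ n (h : A → A) (f : Cochain A) u → θ n h (d f) u ≡ d (θ n h f) u
    θ-d zero h f u = refl
    θ-d (suc n) h = alternating-d n h

    iterate : ℕ → (A → A) → A → A
    iterate zero h x = x
    iterate (suc j) h x = iterate j h (h x)

    -- Consecutive differences telescope; over a full period the two ends agree, which gives
    -- `norm-Δ`.
    orbitSum-Δ : ∀ j (h : A → A) (f : Cochain A) u →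
      orbitSum j h (Δ h f) u ≡ f (iterate j (map h) u) + -1ℤ * f u
    orbitSum-Δ zero h f u = sym (lemma (f u))
      where
      lemma : ∀ a → a + -1ℤ * a ≡ 0ℤ
      lemma = solve-∀
    orbitSum-Δ (suc j) h f u rewrite orbitSum-Δ j h (f ∘ map h) u =
      trans (lemma (f (map h u)) (f u) (f (map h (iterate j (map h) u))))
            (cong (λ v → f v + -1ℤ * f u) (commute j u))
      where
      lemma : ∀ a b c → (a + -1ℤ * b) + 1ℤ * (c + -1ℤ * a) ≡ c + -1ℤ * b
      lemma = solve-∀
      commute : ∀ j u → map h (iterate j (map h) u) ≡ iterate j (map h) (map h u)
      commute zero u = refl
      commute (suc j) u = commute j (map h u)

    orbitSum-shift : ∀ j (h : A → A) (f : Cochain A) u → orbitSum j h f (map h u) ≡ orbitSum j h (f ∘ map h) u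
    orbitSum-shift zero h f u = refl
    orbitSum-shift (suc j) h f u = cong (λ a → f (map h u) + 1ℤ * a) (orbitSum-shift j h (f ∘ map h) u)

    module _ (h : A → A) (periodic : ∀ u → iterate p (map h) u ≡ u) where

      norm-Δ : ∀ f u → norm h (Δ h f) u ≡ 0ℤ
      norm-Δ f u rewrite orbitSum-Δ p h f u | periodic u = lemma (f u)
        where
        lemma : ∀ a → a + -1ℤ * a ≡ 0ℤ
        lemma = solve-∀

      Δ-norm : ∀ f u → Δ h (norm h f) u ≡ 0ℤ
      Δ-norm f u = begin
        norm h f (map h u) + -1ℤ * norm h f u      ≡⟨ cong (_+ -1ℤ * norm h f u) (orbitSum-shift p h f u) ⟩
        norm h (f ∘ map h) u + -1ℤ * norm h f u    ≡⟨ orbitSum-linear p h -1ℤ (f ∘ map h) f u ⟨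
        norm h (Δ h f) u                           ≡⟨ norm-Δ f u ⟩
        0ℤ                                         ∎
        where open ≡-Reasoning

      alternating² : ∀ n f u → alternating n h (alternating (suc n) h f) u ≡ 0ℤ
      alternating² zero = Δ-norm
      alternating² (suc zero) = norm-Δ
      alternating² (suc (suc n)) = alternating² n

    -- Evaluation on the chain e(i ∷ is) = v i * θ e(is), an equivariant image of the
    -- periodic resolution of the cyclic group in the tuples over V.
    module Cone {V I : Set} (v : I → V) (τ : V → V) (periodic : ∀ u → iterate p (map τ) u ≡ u) where

      E : List I → Cochain V → ℤ
      E [] f = f []
      E (i ∷ is) f = E is (θ (length is) τ (λ u → f (v i ∷ u)))

      E-cong : ∀ is {f g} → f ≗ g → E is f ≡ E is g
      E-cong [] e = e []
      E-cong (i ∷ is) e = E-cong is (θ-cong (length is) τ (λ u → e (v i ∷ u)))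

      E-linear : ∀ is c f g → E is (λ l → f l + c * g l) ≡ E is f + c * E is g
      E-linear [] c f g = refl
      E-linear (i ∷ is) c f g =
        trans (E-cong is (θ-linear (length is) τ c _ _)) (E-linear is c _ _)

      E-zero : ∀ is → E is (λ _ → 0ℤ) ≡ 0ℤ
      E-zero is = trans (E-linear is -1ℤ (λ _ → 0ℤ) (λ _ → 0ℤ)) (lemma (E is (λ _ → 0ℤ)))
        where
        lemma : ∀ a → a + -1ℤ * a ≡ 0ℤ
        lemma = solve-∀

      -- The boundary of a cone v * c is c - v * ∂c. Here c = θ e(is) is a cycle by `E-θ-d`, since
      -- consecutive differentials compose to zero, so the base alone remains.
      E-d : ∀ i is f → E (i ∷ is) (d f) ≡ E is (θ (length is) τ f)
      E-θ-d : ∀ is f → E is (θ (length is) τ (d f)) ≡ 0ℤ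

      E-d i is f = begin
        E is (θ n τ (λ u → f u + -1ℤ * d f′ u))
          ≡⟨ E-cong is (θ-linear n τ -1ℤ f (d f′)) ⟩
        E is (λ u → θ n τ f u + -1ℤ * θ n τ (d f′) u)
          ≡⟨ E-linear is -1ℤ (θ n τ f) (θ n τ (d f′)) ⟩
        E is (θ n τ f) + -1ℤ * E is (θ n τ (d f′))
          ≡⟨ cong (λ a → E is (θ n τ f) + -1ℤ * a) (E-θ-d is f′) ⟩
        E is (θ n τ f) + -1ℤ * 0ℤ
          ≡⟨ ℤ.+-identityʳ _ ⟩
        E is (θ n τ f) ∎
        where
        open ≡-Reasoning
        n = length is
        f′ = λ u → f (v i ∷ u)

      E-θ-d [] f = refl
      E-θ-d (j ∷ js) f = begin
        E (j ∷ js) (θ (suc n) τ (d f))  ≡⟨ E-cong (j ∷ js) (θ-d (suc n) τ f) ⟩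
        E (j ∷ js) (d (θ (suc n) τ f))  ≡⟨ E-d j js (θ (suc n) τ f) ⟩
        E js (θ n τ (θ (suc n) τ f))    ≡⟨ θθ js ⟩
        0ℤ                              ∎
        where
        open ≡-Reasoning
        n = length js
        θθ : ∀ js → E js (θ (length js) τ (θ (suc (length js)) τ f)) ≡ 0ℤ
        -- The augmentation kills T - 1, because the empty tuple is fixed by `τ`.
        θθ [] = lemma (f [])
          where
          lemma : ∀ a → a + -1ℤ * a ≡ 0ℤ
          lemma = solve-∀
        θθ (j ∷ js) = trans (E-cong (j ∷ js) (alternating² τ periodic (length js) f)) (E-zero (j ∷ js))

  -- The cyclic group and the map from its bar resolution to the periodic one

  module CyclicGroup (q : ℕ) where

    p = suc q

    open Periodic p public

    G = Fin p

    -- Addition of 1 in ℤ/p.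
    t : Fin p → Fin p
    t a with view a
    ... | ‵fromℕ = zero
    ... | ‵inject₁ b = suc b

    t-last : t (fromℕ q) ≡ zero
    t-last rewrite view-fromℕ q = refl

    t-inject₁ : ∀ b → t (inject₁ b) ≡ suc b
    t-inject₁ b rewrite view-inject₁ b = refl

    toℕ-iterate-t : ∀ j a → toℕ a ℕ.+ j ℕ.≤ q → toℕ (iterate j t a) ≡ toℕ a ℕ.+ j
    toℕ-iterate-t zero a le = sym (ℕ.+-identityʳ _)
    toℕ-iterate-t (suc j) a le with view a
    ... | ‵fromℕ = ⊥-elim (ℕ.<-irrefl refl (ℕ.≤-trans (ℕ.m<m+n q ℕ.z<s) (subst (λ x → x ℕ.+ suc j ℕ.≤ q) (Fin.toℕ-fromℕ q) le)))
    ... | ‵inject₁ b rewrite Fin.toℕ-inject₁ b | ℕ.+-suc (toℕ b) j = toℕ-iterate-t j (suc b) le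

    iterate-+ : ∀ i j (h : A → A) x → iterate (i ℕ.+ j) h x ≡ iterate j h (iterate i h x)
    iterate-+ zero j h x = refl
    iterate-+ (suc i) j h x = iterate-+ i j h (h x)

    iterate-suc : ∀ j (h : A → A) x → iterate (suc j) h x ≡ h (iterate j h x)
    iterate-suc zero h x = refl
    iterate-suc (suc j) h x = iterate-suc j h (h x)

    iterate-p : ∀ a → iterate p t a ≡ a
    iterate-p a = begin
      iterate p t a                                  ≡⟨ cong (λ j → iterate j t a) split ⟩
      iterate (b ℕ.+ suc (toℕ a)) t a                ≡⟨ iterate-+ b (suc (toℕ a)) t a ⟩
      iterate (toℕ a) t (t (iterate b t a))          ≡⟨ cong (λ x → iterate (toℕ a) t (t x)) last ⟩
      iterate (toℕ a) t (t (fromℕ q))                ≡⟨ cong (iterate (toℕ a) t) t-last ⟩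
      iterate (toℕ a) t zero                         ≡⟨ Fin.toℕ-injective (toℕ-iterate-t (toℕ a) zero a≤q) ⟩
      a                                              ∎
      where
      open ≡-Reasoning
      a≤q = ℕ.≤-pred (Fin.toℕ<n a)
      b = q ℕ.∸ toℕ a
      split : p ≡ b ℕ.+ suc (toℕ a)
      split = sym (trans (ℕ.+-suc b (toℕ a)) (cong suc (ℕ.m∸n+n≡m a≤q)))
      last : iterate b t a ≡ fromℕ q
      last = Fin.toℕ-injective (trans (toℕ-iterate-t b a (ℕ.≤-reflexive (ℕ.m+[n∸m]≡n a≤q)))
                                      (trans (ℕ.m+[n∸m]≡n a≤q) (sym (Fin.toℕ-fromℕ q))))

    iterate-map : ∀ j (h : A → A) x u → iterate j (map h) (x ∷ u) ≡ iterate j h x ∷ iterate j (map h) u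
    iterate-map zero h x u = refl
    iterate-map (suc j) h x u = iterate-map j h (h x) (map h u)

    iterate-map-[] : ∀ j (h : A → A) → iterate j (map h) [] ≡ []
    iterate-map-[] zero h = refl
    iterate-map-[] (suc j) h = iterate-map-[] j h

    map-periodic : ∀ (h : A → A) → (∀ x → iterate p h x ≡ x) → ∀ u → iterate p (map h) u ≡ u
    map-periodic h e [] = iterate-map-[] p h
    map-periodic h e (x ∷ u) = trans (iterate-map p h x u) (cong₂ _∷_ (e x) (map-periodic h e u))

    -- A step from a to b along the cycle passes from the last element to zero iff b < a.
    χ : G → G → ℤ
    χ a b = if toℕ b <ᵇ toℕ a then 1ℤ else 0ℤ

    δ : G → ℤ
    δ a with view a
    ... | ‵fromℕ = 1ℤ
    ... | ‵inject₁ _ = 0ℤ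

    n<ᵇn : ∀ n → (n <ᵇ n) ≡ false
    n<ᵇn zero = refl
    n<ᵇn (suc n) = n<ᵇn n

    <⇒<ᵇ-true : ∀ {m n} → m ℕ.< n → (m <ᵇ n) ≡ true
    <⇒<ᵇ-true {zero} {suc n} _ = refl
    <⇒<ᵇ-true {suc m} {suc n} (s≤s lt) = <⇒<ᵇ-true lt

    ≤⇒<ᵇ-false : ∀ {m n} → m ℕ.≤ n → (n <ᵇ m) ≡ false
    ≤⇒<ᵇ-false {zero} _ = refl
    ≤⇒<ᵇ-false {suc m} {suc n} (s≤s le) = ≤⇒<ᵇ-false le

    χ-refl : ∀ a → χ a a ≡ 0ℤ
    χ-refl a rewrite n<ᵇn (toℕ a) = refl

    -- Applying `t` moves the wrap-around point by one step, so `χ` changes by the coboundary of the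
    -- indicator `δ` of the last element.
    χ-t : ∀ a b → χ (t a) (t b) + -1ℤ * χ a b ≡ δ b + -1ℤ * δ a
    χ-t a b with view a | view b
    ... | ‵fromℕ | ‵fromℕ rewrite n<ᵇn (toℕ (fromℕ q)) = refl
    ... | ‵fromℕ | ‵inject₁ b′
      rewrite <⇒<ᵇ-true {toℕ (inject₁ b′)} {toℕ (fromℕ q)}
        (subst₂ ℕ._<_ (sym (Fin.toℕ-inject₁ b′)) (sym (Fin.toℕ-fromℕ q)) (Fin.toℕ<n b′)) = refl
    ... | ‵inject₁ a′ | ‵fromℕ
      rewrite ≤⇒<ᵇ-false {toℕ (inject₁ a′)} {toℕ (fromℕ q)}
        (subst₂ ℕ._≤_ (sym (Fin.toℕ-inject₁ a′)) (sym (Fin.toℕ-fromℕ q)) (ℕ.<⇒≤ (Fin.toℕ<n a′))) = refl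
    ... | ‵inject₁ a′ | ‵inject₁ b′
      rewrite Fin.toℕ-inject₁ a′ | Fin.toℕ-inject₁ b′ = lemma (if toℕ b′ <ᵇ toℕ a′ then 1ℤ else 0ℤ)
      where
      lemma : ∀ x → x + -1ℤ * x ≡ 0ℤ + -1ℤ * 0ℤ
      lemma = solve-∀

    -- The coboundary of `χ`: the carry cocycle of ℤ/p in homogeneous form.
    β : G → G → G → ℤ
    β a b c = χ b c + -1ℤ * (χ a c + -1ℤ * χ a b)

    -- By `χ-t` the change of `χ` is itself a coboundary, and a second coboundary annihilates it.
    β-t : ∀ a b c → β (t a) (t b) (t c) ≡ β a b c
    β-t a b c = lemma (χ (t b) (t c)) (χ (t a) (t c)) (χ (t a) (t b)) (χ b c) (χ a c) (χ a b) (δ a) (δ b) (δ c) (χ-t b c) (χ-t a c) (χ-t a b)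
      where
      lemma : ∀ x y z x′ y′ z′ a b c → x + -1ℤ * x′ ≡ c + -1ℤ * b → y + -1ℤ * y′ ≡ c + -1ℤ * a →
        z + -1ℤ * z′ ≡ b + -1ℤ * a → x + -1ℤ * (y + -1ℤ * z) ≡ x′ + -1ℤ * (y′ + -1ℤ * z′)
      lemma x y z x′ y′ z′ a b c ex ey ez = begin
        x + -1ℤ * (y + -1ℤ * z)
          ≡⟨ regroup x y z x′ y′ z′ ⟩
        (x + -1ℤ * x′) + -1ℤ * ((y + -1ℤ * y′) + -1ℤ * (z + -1ℤ * z′)) + (x′ + -1ℤ * (y′ + -1ℤ * z′))
          ≡⟨ cong₂ (λ u v → u + v + (x′ + -1ℤ * (y′ + -1ℤ * z′))) ex (cong₂ (λ u v → -1ℤ * (u + -1ℤ * v)) ey ez) ⟩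
        (c + -1ℤ * b) + -1ℤ * ((c + -1ℤ * a) + -1ℤ * (b + -1ℤ * a)) + (x′ + -1ℤ * (y′ + -1ℤ * z′))
          ≡⟨ cancel a b c _ ⟩
        x′ + -1ℤ * (y′ + -1ℤ * z′) ∎
        where
        open ≡-Reasoning
        regroup : ∀ x y z x′ y′ z′ → x + -1ℤ * (y + -1ℤ * z) ≡
          (x + -1ℤ * x′) + -1ℤ * ((y + -1ℤ * y′) + -1ℤ * (z + -1ℤ * z′)) + (x′ + -1ℤ * (y′ + -1ℤ * z′))
        regroup = solve-∀
        cancel : ∀ a b c w → (c + -1ℤ * b) + -1ℤ * ((c + -1ℤ * a) + -1ℤ * (b + -1ℤ * a)) + w ≡ w
        cancel = solve-∀

    infixr 7 β∪_
    -- The cup product with the cocycle on the left; the two factors share the vertex `c`.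
    β∪_ : Cochain G → Cochain G
    (β∪ κ) (a ∷ b ∷ c ∷ l) = β a b c * κ (c ∷ l)
    (β∪ κ) _ = 0ℤ

    β∪-cong : ∀ {κ κ′} → κ ≗ κ′ → β∪ κ ≗ β∪ κ′
    β∪-cong e [] = refl
    β∪-cong e (_ ∷ []) = refl
    β∪-cong e (_ ∷ _ ∷ []) = refl
    β∪-cong e (a ∷ b ∷ c ∷ l) = cong (β a b c *_) (e (c ∷ l))

    β∪-linear : ∀ x κ κ′ l → (β∪ λ l → κ l + x * κ′ l) l ≡ (β∪ κ) l + x * (β∪ κ′) l
    β∪-linear x κ κ′ [] = sym (trans (ℤ.+-identityˡ _) (ℤ.*-zeroʳ x))
    β∪-linear x κ κ′ (_ ∷ []) = sym (trans (ℤ.+-identityˡ _) (ℤ.*-zeroʳ x))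
    β∪-linear x κ κ′ (_ ∷ _ ∷ []) = sym (trans (ℤ.+-identityˡ _) (ℤ.*-zeroʳ x))
    β∪-linear x κ κ′ (a ∷ b ∷ c ∷ l) = lemma (β a b c) x (κ (c ∷ l)) (κ′ (c ∷ l))
      where
      lemma : ∀ b x y z → b * (y + x * z) ≡ b * y + x * (b * z)
      lemma = solve-∀

    β∪-t : ∀ κ l → (β∪ κ) (map t l) ≡ (β∪ (κ ∘ map t)) l
    β∪-t κ [] = refl
    β∪-t κ (_ ∷ []) = refl
    β∪-t κ (_ ∷ _ ∷ []) = refl
    β∪-t κ (a ∷ b ∷ c ∷ l) = cong (_* κ (t c ∷ map t l)) (β-t a b c)

    orbitSum-β∪ : ∀ j κ l → orbitSum j t (β∪ κ) l ≡ (β∪ orbitSum j t κ) l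
    orbitSum-β∪ zero κ [] = refl
    orbitSum-β∪ zero κ (_ ∷ []) = refl
    orbitSum-β∪ zero κ (_ ∷ _ ∷ []) = refl
    orbitSum-β∪ zero κ (a ∷ b ∷ c ∷ l) = sym (ℤ.*-zeroʳ (β a b c))
    orbitSum-β∪ (suc j) κ l = begin
      (β∪ κ) l + 1ℤ * orbitSum j t ((β∪ κ) ∘ map t) l
        ≡⟨ cong (λ a → (β∪ κ) l + 1ℤ * a) (orbitSum-cong j t (β∪-t κ) l) ⟩
      (β∪ κ) l + 1ℤ * orbitSum j t (β∪ (κ ∘ map t)) l
        ≡⟨ cong (λ a → (β∪ κ) l + 1ℤ * a) (orbitSum-β∪ j (κ ∘ map t) l) ⟩
      (β∪ κ) l + 1ℤ * (β∪ orbitSum j t (κ ∘ map t)) l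
        ≡⟨ β∪-linear 1ℤ κ (orbitSum j t (κ ∘ map t)) l ⟨
      (β∪ orbitSum (suc j) t κ) l ∎
      where open ≡-Reasoning

    alternating-β∪ : ∀ n κ l → alternating n t (β∪ κ) l ≡ (β∪ alternating n t κ) l
    alternating-β∪ zero κ l = begin
      (β∪ κ) (map t l) + -1ℤ * (β∪ κ) l      ≡⟨ cong (_+ -1ℤ * (β∪ κ) l) (β∪-t κ l) ⟩
      (β∪ (κ ∘ map t)) l + -1ℤ * (β∪ κ) l    ≡⟨ β∪-linear -1ℤ (κ ∘ map t) κ l ⟨
      (β∪ Δ t κ) l                           ∎
      where open ≡-Reasoning
    alternating-β∪ (suc zero) = orbitSum-β∪ p
    alternating-β∪ (suc (suc n)) = alternating-β∪ n

    -- The Leibniz rule for the cocycle β.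
    d-β∪ : ∀ κ → κ [] ≡ 0ℤ → ∀ l → d (β∪ κ) l ≡ (β∪ d κ) l
    d-β∪ κ z [] = refl
    d-β∪ κ z (_ ∷ []) = refl
    d-β∪ κ z (_ ∷ _ ∷ []) = refl
    d-β∪ κ z (a ∷ b ∷ c ∷ []) rewrite z = sym (ℤ.*-zeroʳ (β a b c))
    d-β∪ κ z (a ∷ b ∷ c ∷ e ∷ l)
      rewrite d-scale (β a b c) (λ m → κ (c ∷ m)) (e ∷ l) =
      lemma (χ a b) (χ a c) (χ a e) (χ b c) (χ b e) (χ c e) (κ (e ∷ l)) (d (λ m → κ (c ∷ e ∷ m)) l) (κ (c ∷ l))
      where
      lemma : ∀ ab ac ae bc be ce k D K →
        (ce + -1ℤ * (be + -1ℤ * bc)) * k + -1ℤ * ((ce + -1ℤ * (ae + -1ℤ * ac)) * k + -1ℤ *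
          ((be + -1ℤ * (ae + -1ℤ * ab)) * k + -1ℤ * ((bc + -1ℤ * (ac + -1ℤ * ab)) * (K + -1ℤ * D))))
        ≡ (bc + -1ℤ * (ac + -1ℤ * ab)) * (k + -1ℤ * (K + -1ℤ * D))
      lemma = solve-∀

    -- `δ` and `χ` in the two bottom degrees, then one more factor `β` for every two degrees,
    -- matching the period two of the resolution.
    K : ℕ → Cochain G
    K zero (a ∷ []) = δ a
    K zero _ = 0ℤ
    K (suc zero) (a ∷ b ∷ []) = χ a b
    K (suc zero) _ = 0ℤ
    K (suc (suc n)) = β∪ K n

    K-[] : ∀ n → K n [] ≡ 0ℤ
    K-[] zero = refl
    K-[] (suc zero) = refl
    K-[] (suc (suc n)) = refl

    -- An orbit meets the last element exactly once. Invariance of the norm reduces `a` to zero, and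
    -- the p terms starting at zero reach the last element at their very end.
    norm-δ : ∀ a → norm t (K 0) (a ∷ []) ≡ 1ℤ
    norm-δ a = by-toℕ (toℕ a) a refl
      where
      open ≡-Reasoning
      invariant : ∀ b → norm t (K 0) (t b ∷ []) ≡ norm t (K 0) (b ∷ [])
      invariant b = ℤ.i-j≡0⇒i≡j _ _ (trans (cong (λ x → norm t (K 0) (t b ∷ []) + x) (sym (ℤ.-1*i≡-i _)))
                                            (Δ-norm t (map-periodic t iterate-p) (K 0) (b ∷ [])))
      δ-inject₁ : ∀ b → δ (inject₁ b) ≡ 0ℤ
      δ-inject₁ b rewrite view-inject₁ b = refl
      δ-last : δ (fromℕ q) ≡ 1ℤ
      δ-last rewrite view-fromℕ q = refl
      from : ∀ j {b} → View b → toℕ b ℕ.+ j ≡ q → orbitSum (suc j) t (K 0) (b ∷ []) ≡ 1ℤ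
      from zero ‵fromℕ e = cong (_+ 0ℤ) δ-last
      from (suc j) ‵fromℕ e = ⊥-elim (ℕ.m≢1+m+n q (trans (sym e) (trans (cong (ℕ._+ suc j) (Fin.toℕ-fromℕ q)) (ℕ.+-suc q j))))
      from zero (‵inject₁ b) e = ⊥-elim (ℕ.<-irrefl (trans (sym (Fin.toℕ-inject₁ b)) (trans (sym (ℕ.+-identityʳ _)) e)) (Fin.toℕ<n b))
      from (suc j) (‵inject₁ b) e = begin
        δ (inject₁ b) + 1ℤ * orbitSum (suc j) t (K 0 ∘ map t) (inject₁ b ∷ [])
          ≡⟨ cong₂ (λ x y → x + 1ℤ * y) (δ-inject₁ b) (sym (orbitSum-shift (suc j) t (K 0) (inject₁ b ∷ []))) ⟩
        0ℤ + 1ℤ * orbitSum (suc j) t (K 0) (t (inject₁ b) ∷ [])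
          ≡⟨ cong (λ x → 0ℤ + 1ℤ * orbitSum (suc j) t (K 0) (x ∷ [])) (t-inject₁ b) ⟩
        0ℤ + 1ℤ * orbitSum (suc j) t (K 0) (suc b ∷ [])
          ≡⟨ cong (λ x → 0ℤ + 1ℤ * x) (from j (view (suc b)) (trans (sym (ℕ.+-suc (toℕ b) j)) (trans (cong (ℕ._+ suc j) (sym (Fin.toℕ-inject₁ b))) e))) ⟩
        1ℤ ∎
      by-toℕ : ∀ j a → toℕ a ≡ j → norm t (K 0) (a ∷ []) ≡ 1ℤ
      by-toℕ zero zero e = from q (view zero) refl
      by-toℕ (suc j) (suc b) e = begin
        norm t (K 0) (suc b ∷ [])          ≡⟨ cong (λ x → norm t (K 0) (x ∷ [])) (t-inject₁ b) ⟨
        norm t (K 0) (t (inject₁ b) ∷ [])  ≡⟨ invariant (inject₁ b) ⟩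
        norm t (K 0) (inject₁ b ∷ [])      ≡⟨ by-toℕ j (inject₁ b) (trans (Fin.toℕ-inject₁ b) (ℕ.suc-injective e)) ⟩
        1ℤ                                 ∎

    norm-δ-long : ∀ j a b l → orbitSum j t (K 0) (a ∷ b ∷ l) ≡ 0ℤ
    norm-δ-long zero a b l = refl
    norm-δ-long (suc j) a b l
      rewrite sym (orbitSum-shift j t (K 0) (a ∷ b ∷ l)) | norm-δ-long j (t a) (t b) (map t l) = refl

    -- K is the chain map from the bar resolution to the periodic resolution.
    d-K : ∀ n → d (K n) ≗ alternating n t (K (suc n))
    d-K zero [] = refl
    d-K zero (a ∷ []) = refl
    d-K zero (a ∷ b ∷ []) = trans (cong (λ x → δ b + -1ℤ * x) (ℤ.+-identityʳ (δ a))) (sym (χ-t a b))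
    d-K zero (a ∷ b ∷ c ∷ l) rewrite d-vanish (λ m → K 0 (a ∷ b ∷ m)) (c ∷ l) (λ _ _ → refl) = refl
    d-K (suc zero) l = trans (dχ l) (sym (orbitSum-β∪ p (K 0) l))
      where
      dχ : ∀ l → d (K 1) l ≡ (β∪ norm t (K 0)) l
      dχ [] = refl
      dχ (_ ∷ []) = refl
      dχ (_ ∷ _ ∷ []) = refl
      dχ (a ∷ b ∷ c ∷ []) rewrite norm-δ c = lemma (χ b c) (χ a c) (χ a b)
        where
        lemma : ∀ x y z → x + -1ℤ * (y + -1ℤ * (z + -1ℤ * 0ℤ)) ≡ (x + -1ℤ * (y + -1ℤ * z)) * 1ℤ
        lemma = solve-∀
      dχ (a ∷ b ∷ c ∷ e ∷ l)
        rewrite norm-δ-long p c e l | d-vanish (λ m → K 1 (a ∷ b ∷ c ∷ m)) (e ∷ l) (λ _ _ → refl)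
        = sym (ℤ.*-zeroʳ (β a b c))
    d-K (suc (suc n)) l = begin
      d (β∪ K n) l                       ≡⟨ d-β∪ (K n) (K-[] n) l ⟩
      (β∪ d (K n)) l                     ≡⟨ β∪-cong (d-K n) l ⟩
      (β∪ alternating n t (K (suc n))) l ≡⟨ alternating-β∪ n (K (suc n)) l ⟨
      alternating n t (β∪ K (suc n)) l   ∎
      where open ≡-Reasoning

    -- Vanishing on degenerate tuples. A flag in which two consecutive signs agree then contributes
    -- nothing.
    Normalized : Cochain G → Set
    Normalized κ = ∀ l g m → κ (l ++ g ∷ g ∷ m) ≡ 0ℤ

    -- `β` vanishes if two consecutive arguments agree, as `χ g g` is 0; a repetition further along
    -- falls to the other factor.
    K-normalized : ∀ n → Normalized (K n)
    K-normalized zero [] g m = refl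
    K-normalized zero (_ ∷ []) g m = refl
    K-normalized zero (_ ∷ _ ∷ l) g m = refl
    K-normalized (suc zero) [] g [] = χ-refl g
    K-normalized (suc zero) [] g (_ ∷ _) = refl
    K-normalized (suc zero) (_ ∷ []) g m = refl
    K-normalized (suc zero) (_ ∷ _ ∷ []) g m = refl
    K-normalized (suc zero) (_ ∷ _ ∷ _ ∷ _) g m = refl
    K-normalized (suc (suc n)) [] g [] = refl
    K-normalized (suc (suc n)) [] g (c ∷ m) rewrite χ-refl g = lemma (χ g c) (K n (c ∷ m))
      where
      lemma : ∀ x y → (x + -1ℤ * (x + -1ℤ * 0ℤ)) * y ≡ 0ℤ
      lemma = solve-∀
    K-normalized (suc (suc n)) (a ∷ []) g m rewrite χ-refl g = lemma (χ a g) (K n (g ∷ m))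
      where
      lemma : ∀ x y → (0ℤ + -1ℤ * (x + -1ℤ * x)) * y ≡ 0ℤ
      lemma = solve-∀
    K-normalized (suc (suc n)) (a ∷ b ∷ []) g m rewrite K-normalized n [] g m = ℤ.*-zeroʳ (β a b g)
    K-normalized (suc (suc n)) (a ∷ b ∷ c ∷ l) g m rewrite K-normalized n (c ∷ l) g m = ℤ.*-zeroʳ (β a b c)

    orbitSum-normalized : ∀ j κ → Normalized κ → Normalized (orbitSum j t κ)
    orbitSum-normalized zero κ z l g m = refl
    orbitSum-normalized (suc j) κ z l g m
      rewrite z l g m | orbitSum-normalized j (κ ∘ map t) (λ l g m →
        trans (cong κ (map-++ t l (g ∷ g ∷ m))) (z (map t l) (t g) (map t m))) l g m = refl

    -- The degree modulo p and the ℤ/p-version of Tucker's lemma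

    module Signs {I : Set} (σ : List (I × G) → G)
      (σ-equivariant : ∀ x u → σ (map (map₂ t) (x ∷ u)) ≡ t (σ (x ∷ u))) where

      τ : I × G → I × G
      τ = map₂ t

      τ-periodic : ∀ x → iterate p τ x ≡ x
      τ-periodic (i , a) = trans (pair p a) (cong (i ,_) (iterate-p a))
        where
        pair : ∀ j a → iterate j τ (i , a) ≡ (i , iterate j t a)
        pair zero a = refl
        pair (suc j) a = pair j (t a)

      open Subdivision σ
      open Cone (λ i → i , zero) τ (map-periodic τ τ-periodic)

      orbitSum-S : ∀ j n κ u → orbitSum j τ (S n κ) u ≡ S n (orbitSum j t κ) u
      orbitSum-S zero n κ u = sym (S-zero n _ (λ _ → refl) u)
      orbitSum-S (suc j) n κ u = begin
        S n κ u + 1ℤ * orbitSum j τ (S n κ ∘ map τ) u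
          ≡⟨ cong (λ a → S n κ u + 1ℤ * a) (orbitSum-cong j τ (S-equivariant τ t σ-equivariant n κ) u) ⟩
        S n κ u + 1ℤ * orbitSum j τ (S n (κ ∘ map t)) u
          ≡⟨ cong (λ a → S n κ u + 1ℤ * a) (orbitSum-S j n (κ ∘ map t) u) ⟩
        S n κ u + 1ℤ * S n (orbitSum j t (κ ∘ map t)) u
          ≡⟨ S-linear n 1ℤ κ (orbitSum j t (κ ∘ map t)) u ⟨
        S n (orbitSum (suc j) t κ) u ∎
        where open ≡-Reasoning

      alternating-S : ∀ k n κ u → alternating k τ (S n κ) u ≡ S n (alternating k t κ) u
      alternating-S zero n κ u =
        trans (cong (_+ -1ℤ * S n κ u) (S-equivariant τ t σ-equivariant n κ u))
              (sym (S-linear n -1ℤ (κ ∘ map t) κ u))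
      alternating-S (suc zero) = orbitSum-S p
      alternating-S (suc (suc k)) = alternating-S k

      θ-S : ∀ k n κ u → θ k τ (S n κ) u ≡ S n (θ k t κ) u
      θ-S zero n κ u = refl
      θ-S (suc k) = alternating-S k

      -- The composite chain map, dually: a cochain on the group is pulled back along signs and
      -- subdivision, then evaluated on the cone chain.
      F : List I → Cochain G → ℤ
      F is κ = E is (S (length is) κ)

      F-cong : ∀ is {κ κ′} → κ ≗ κ′ → F is κ ≡ F is κ′
      F-cong is e = E-cong is (S-cong (length is) e)

      F-linear : ∀ is c κ κ′ → F is (λ l → κ l + c * κ′ l) ≡ F is κ + c * F is κ′
      F-linear is c κ κ′ = trans (E-cong is (S-linear (length is) c κ κ′)) (E-linear is c _ _)

      F-zero : ∀ is → F is (λ _ → 0ℤ) ≡ 0ℤ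
      F-zero is = trans (E-cong is (S-zero (length is) _ (λ _ → refl))) (E-zero is)

      F-d : ∀ i is κ → F (i ∷ is) (d κ) ≡ F is (θ (length is) t κ)
      F-d i is κ = begin
        E (i ∷ is) (S (suc n) (d κ))   ≡⟨ E-cong (i ∷ is) (S-d n κ) ⟩
        E (i ∷ is) (d (S n κ))         ≡⟨ E-d i is (S n κ) ⟩
        E is (θ n τ (S n κ))           ≡⟨ E-cong is (θ-S n n κ) ⟩
        E is (S n (θ n t κ))           ∎
        where
        open ≡-Reasoning
        n = length is

      -- The discrepancies F(tʲκ₁) − F(tʲκ₀) do not depend on j, so that they add up to a multiple of p.
      norm-step-Δ : ∀ i is κ₀ κ₁ → (∀ κ → F (i ∷ is) (d κ) ≡ F is (Δ t κ)) → d κ₀ ≗ Δ t κ₁ → ∀ j →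
        F (i ∷ is) (orbitSum j t κ₁) ≡ F is (orbitSum j t κ₀) + + j * (F (i ∷ is) κ₁ + -1ℤ * F is κ₀)
      norm-step-Δ i is κ₀ κ₁ F-d e zero =
        trans (F-zero (i ∷ is)) (sym (trans (cong (_+ 0ℤ) (F-zero is)) refl))
      norm-step-Δ i is κ₀ κ₁ F-d e (suc j) = begin
        F js (orbitSum (suc j) t κ₁)
          ≡⟨ F-linear js 1ℤ κ₁ (orbitSum j t κ₁′) ⟩
        F js κ₁ + 1ℤ * F js (orbitSum j t κ₁′)
          ≡⟨ cong (λ x → F js κ₁ + 1ℤ * x) (norm-step-Δ i is κ₀′ κ₁′ F-d e′ j) ⟩
        F js κ₁ + 1ℤ * (F is (orbitSum j t κ₀′) + + j * (F js κ₁′ + -1ℤ * F is κ₀′))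
          ≡⟨ cong (λ x → F js κ₁ + 1ℤ * (F is (orbitSum j t κ₀′) + + j * x)) shift ⟩
        F js κ₁ + 1ℤ * (F is (orbitSum j t κ₀′) + + j * (F js κ₁ + -1ℤ * F is κ₀))
          ≡⟨ collect (F js κ₁) (F is κ₀) (F is (orbitSum j t κ₀′)) (+ j) ⟩
        (F is κ₀ + 1ℤ * F is (orbitSum j t κ₀′)) + + suc j * (F js κ₁ + -1ℤ * F is κ₀)
          ≡⟨ cong (_+ + suc j * (F js κ₁ + -1ℤ * F is κ₀)) (F-linear is 1ℤ κ₀ (orbitSum j t κ₀′)) ⟨
        F is (orbitSum (suc j) t κ₀) + + suc j * (F js κ₁ + -1ℤ * F is κ₀) ∎
        where
        open ≡-Reasoning
        js = i ∷ is
        κ₀′ = κ₀ ∘ map t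
        κ₁′ = κ₁ ∘ map t
        e′ : d κ₀′ ≗ Δ t κ₁′
        e′ u = trans (d-map t κ₀ u) (e (map t u))
        collect : ∀ a b x n → a + 1ℤ * (x + n * (a + -1ℤ * b)) ≡ (b + 1ℤ * x) + (1ℤ + n) * (a + -1ℤ * b)
        collect = solve-∀
        difference : F js κ₁′ + -1ℤ * F js κ₁ ≡ F is κ₀′ + -1ℤ * F is κ₀
        difference = begin
          F js κ₁′ + -1ℤ * F js κ₁  ≡⟨ F-linear js -1ℤ κ₁′ κ₁ ⟨
          F js (Δ t κ₁)            ≡⟨ F-cong js e ⟨
          F js (d κ₀)              ≡⟨ F-d κ₀ ⟩
          F is (Δ t κ₀)           ≡⟨ F-linear is -1ℤ κ₀′ κ₀ ⟩
          F is κ₀′ + -1ℤ * F is κ₀ ∎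
        shift : F js κ₁′ + -1ℤ * F is κ₀′ ≡ F js κ₁ + -1ℤ * F is κ₀
        shift = begin
          F js κ₁′ + -1ℤ * F is κ₀′
            ≡⟨ rearrange (F js κ₁′) (F js κ₁) (F is κ₀′) ⟩
          (F js κ₁′ + -1ℤ * F js κ₁) + F js κ₁ + -1ℤ * F is κ₀′
            ≡⟨ cong (λ x → x + F js κ₁ + -1ℤ * F is κ₀′) difference ⟩
          (F is κ₀′ + -1ℤ * F is κ₀) + F js κ₁ + -1ℤ * F is κ₀′
            ≡⟨ rearrange′ (F js κ₁) (F is κ₀′) (F is κ₀) ⟩
          F js κ₁ + -1ℤ * F is κ₀ ∎
          where
          rearrange : ∀ a b c → a + -1ℤ * c ≡ (a + -1ℤ * b) + b + -1ℤ * c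
          rearrange = solve-∀
          rearrange′ : ∀ b c e → (c + -1ℤ * e) + b + -1ℤ * c ≡ b + -1ℤ * e
          rearrange′ = solve-∀

      -- For the differential T - 1 this is `norm-step-Δ` at j = p. For the norm the equality is
      -- exact, because the norm of `κ₁` is the coboundary of `κ₀`.
      norm-step : ∀ n i is κ₀ κ₁ → (∀ κ → F (i ∷ is) (d κ) ≡ F is (alternating n t κ)) →
        d κ₀ ≗ alternating n t κ₁ → ∃[ z ] F (i ∷ is) (norm t κ₁) ≡ F is (norm t κ₀) + + p * z
      norm-step zero i is κ₀ κ₁ F-d e = _ , norm-step-Δ i is κ₀ κ₁ F-d e p
      norm-step (suc zero) i is κ₀ κ₁ F-d e = 0ℤ ,
        trans (sym (F-cong (i ∷ is) e)) (trans (F-d κ₀) (sym (trans (cong (λ x → F is (norm t κ₀) + x) (ℤ.*-zeroʳ (+ p))) (ℤ.+-identityʳ _))))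
      norm-step (suc (suc n)) = norm-step n

      -- At the bottom, the norm of `δ` is the coboundary of the augmentation, which has value 1;
      -- `norm-step` climbs one dimension at the cost of a multiple of p.
      F-norm-K : ∀ i is → ∃[ z ] F (i ∷ is) (norm t (K (length is))) ≡ 1ℤ + + p * z
      F-norm-K i [] = 0ℤ , (begin
        F (i ∷ []) (norm t (K 0))  ≡⟨ F-cong (i ∷ []) agree ⟩
        F (i ∷ []) (d empty)       ≡⟨ F-d i [] empty ⟩
        1ℤ                         ≡⟨ cong (λ x → 1ℤ + x) (ℤ.*-zeroʳ (+ p)) ⟨
        1ℤ + + p * 0ℤ              ∎)
        where
        open ≡-Reasoning
        empty : Cochain G
        empty [] = 1ℤ
        empty (_ ∷ _) = 0ℤ
        norm-[] : ∀ j → orbitSum j t (K 0) [] ≡ 0ℤ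
        norm-[] zero = refl
        norm-[] (suc j) rewrite sym (orbitSum-shift j t (K 0) []) | norm-[] j = refl
        agree : norm t (K 0) ≗ d empty
        agree [] = norm-[] p
        agree (a ∷ []) = norm-δ a
        agree (a ∷ b ∷ l) rewrite d-vanish (λ m → empty (a ∷ m)) (b ∷ l) (λ _ _ → refl) = norm-δ-long p a b l
      F-norm-K i (j ∷ js) with F-norm-K j js | norm-step (length js) i (j ∷ js) (K (length js)) (K (suc (length js))) (F-d i (j ∷ js)) (d-K (length js))
      ... | z , e | z′ , e′ = z + z′ , trans e′ (trans (cong (_+ + p * z′) e) (lemma (+ p) z z′))
        where
        lemma : ∀ p z z′ → 1ℤ + p * z + p * z′ ≡ 1ℤ + p * (z + z′)
        lemma = solve-∀

      -- The cone chain is supported on tuples with first coordinates `is`, because `τ` moves the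
      -- group coordinate alone.
      E-vanish : ∀ is f → (∀ u → map proj₁ u ≡ is → f u ≡ 0ℤ) → E is f ≡ 0ℤ
      E-vanish [] f z = z [] refl
      E-vanish (i ∷ is) f z = E-vanish is _ (θ-vanish (length is) _ (λ u e → z ((i , zero) ∷ u) (cong (i ∷_) e)))
        where
        Vanishes : Cochain (I × G) → Set
        Vanishes f = ∀ u → map proj₁ u ≡ is → f u ≡ 0ℤ
        shift : ∀ f → Vanishes f → Vanishes (f ∘ map τ)
        shift f z u e = z (map τ u) (trans (sym (map-∘ u)) e)
        orbitSum-vanish : ∀ j f → Vanishes f → Vanishes (orbitSum j τ f)
        orbitSum-vanish zero f z u e = refl
        orbitSum-vanish (suc j) f z u e
          rewrite z u e | orbitSum-vanish j (f ∘ map τ) (shift f z) u e = refl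
        alternating-vanish : ∀ k f → Vanishes f → Vanishes (alternating k τ f)
        alternating-vanish zero f z u e rewrite z u e | shift f z u e = refl
        alternating-vanish (suc zero) f z = orbitSum-vanish p f z
        alternating-vanish (suc (suc k)) f z = alternating-vanish k f z
        θ-vanish : ∀ k f → Vanishes f → Vanishes (θ k τ f)
        θ-vanish zero f z = z
        θ-vanish (suc k) f z = alternating-vanish k f z

      module _ (X : List (I × G) → Set) (X-⊆ : ∀ {u v} → v ⊆ u → X u → X v) (φ : List (I × G) → ℕ)
        (φ-positive : ∀ x u → X (x ∷ u) → 0 ℕ.< φ (x ∷ u))
        (φ-⊆ : ∀ {u v} → v ⊆ u → X u → φ v ℕ.< φ u ⊎ σ v ≡ σ u) where

        -- A potential that is at most n and positive on nonempty lists cannot drop at every step of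
        -- a flag with n + 1 nonempty members. So two consecutive signs agree, and a normalized
        -- cochain does not see the flag.
        S-vanish : ∀ n κ → Normalized κ → ∀ u → X u → φ u ℕ.≤ n → S (suc n) κ u ≡ 0ℤ
        S-vanish zero κ z [] Xu le = refl
        S-vanish zero κ z (x ∷ u) Xu le = ⊥-elim (ℕ.<-irrefl refl (ℕ.<-≤-trans (φ-positive x u Xu) le))
        S-vanish (suc n) κ z u Xu le = d-vanish _ u face
          where
          face : ∀ v → v ⊆ u → S (suc n) (λ l → κ (σ u ∷ l)) v ≡ 0ℤ
          face v s with φ-⊆ s Xu
          ... | inj₁ lt = S-vanish n (λ l → κ (σ u ∷ l)) (λ l → z (σ u ∷ l)) v (X-⊆ s Xu) (ℕ.≤-pred (ℕ.≤-trans lt le))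
          ... | inj₂ e = d-vanish _ v (λ w _ → S-zero n _ (λ l →
            trans (cong (λ g → κ (σ u ∷ g ∷ l)) e) (z [] (σ u) l)) w)

        -- If all tuples over `is` had potential below their length, `S-vanish` would make the
        -- evaluation zero, against the degree 1 modulo p.
        long-flag : 2 ℕ.≤ p → ∀ is → (∀ u → map proj₁ u ≡ is → X u × φ u ℕ.< length is) → ⊥
        long-flag 2≤p [] bound with () ← proj₂ (bound [] refl)
        long-flag 2≤p (i ∷ is) bound with F-norm-K i is
        ... | z , e = ℕ.<-irrefl (sym p≡1) 2≤p
          where
          F≡0 : F (i ∷ is) (norm t (K (length is))) ≡ 0ℤ
          F≡0 = E-vanish (i ∷ is) _ (λ u eu → let Xu , lt = bound u eu in
            S-vanish (length is) (norm t (K (length is))) (orbitSum-normalized p (K (length is)) (K-normalized (length is))) u Xu (ℕ.≤-pred lt))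
          lemma : ∀ x → x ≡ -1ℤ + (1ℤ + x)
          lemma = solve-∀
          -- The same number is 0 and 1 + p z, so p divides 1.
          p≡1 : p ≡ 1
          p≡1 = ℕ.m*n≡1⇒m≡1 p ∣ z ∣ᶻ (trans (sym (ℤ.abs-* (+ p) z))
            (cong ∣_∣ᶻ (trans (lemma (+ p * z)) (cong (λ x → -1ℤ + x) (trans (sym e) F≡0)))))

open Cochains using (module CyclicGroup)

import Algebra.Properties.CommutativeMonoid.Sum
open import Data.Nat using (ℕ; zero; suc; _+_; _*_; _∸_; _^_; _≤_; _<_; _⊓_; z≤n; s≤s; z<s; _<?_; _≤?_; _≟_; NonZero; >-nonZero; nonTrivial⇒n>1)
open import Data.Nat.Coprimality using (prime⇒coprime; coprime-Bézout)
open import Data.Nat.DivMod using (_/_; _%_; m%n<n; m≡m%n+[m/n]*n; m/n*n≤m)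
open import Data.Nat.GCD using (module Bézout)
open import Data.Nat.ListAction using (product)
open import Data.Nat.Primality using (Prime; prime⇒nonTrivial)
open import Data.Nat.Primality.Factorisation using (factorise; module PrimeFactorisation)
open import Data.Nat.Properties
open import Data.Nat.Tactic.RingSolver using (solve-∀)

open Algebra.Properties.CommutativeMonoid.Sum +-0-commutativeMonoid
  using (sum; sum-cong-≗; sum-init-last; sum-remove; ∑-distrib-+; ∑-comm)

private variable
  n : ℕ
  P Q : Set

-- Finite sums, counting and exhaustive search

indicator : Dec P → ℕ
indicator (yes _) = 1
indicator (no _) = 0

indicator≤1 : (P? : Dec P) → indicator P? ≤ 1
indicator≤1 (yes _) = s≤s z≤n
indicator≤1 (no _) = z≤n

indicator-mono : (P? : Dec P) (Q? : Dec Q) → (P → Q) → indicator P? ≤ indicator Q?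
indicator-mono (no _) Q? f = z≤n
indicator-mono (yes x) (yes y) f = s≤s z≤n
indicator-mono (yes x) (no ¬y) f = ⊥-elim (¬y (f x))

indicator-cong : (P? : Dec P) (Q? : Dec Q) → (P → Q) → (Q → P) → indicator P? ≡ indicator Q?
indicator-cong P? Q? f g = ≤-antisym (indicator-mono P? Q? f) (indicator-mono Q? P? g)

indicator-true : (P? : Dec P) → P → indicator P? ≡ 1
indicator-true (yes _) x = refl
indicator-true (no ¬x) x = ⊥-elim (¬x x)

indicator-witness : (P? : Dec P) → indicator P? ≡ 1 → P
indicator-witness (yes x) e = x

sum-mono : ∀ {n} {f g : Fin n → ℕ} → (∀ i → f i ≤ g i) → sum f ≤ sum g
sum-mono {zero} le = z≤n
sum-mono {suc n} le = +-mono-≤ (le zero) (sum-mono (le ∘ suc))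

sum-≤-const : ∀ {n} (f : Fin n → ℕ) k → (∀ i → f i ≤ k) → sum f ≤ n * k
sum-≤-const {zero} f k le = z≤n
sum-≤-const {suc n} f k le = +-mono-≤ (le zero) (sum-≤-const (f ∘ suc) k (le ∘ suc))

term≤sum : ∀ {n} (f : Fin n → ℕ) i → f i ≤ sum f
term≤sum f zero = m≤m+n _ _
term≤sum f (suc i) = ≤-trans (term≤sum (f ∘ suc) i) (m≤n+m _ (f zero))

-- Equal sums leave no room for a strict inequality at any index; in this way an unchanged potential
-- forces unchanged index sets.
sum-mono-≡ : ∀ {n} {f g : Fin n → ℕ} → (∀ i → f i ≤ g i) → sum f ≡ sum g → ∀ i → f i ≡ g i
sum-mono-≡ {suc n} {f} {g} le e = pointwise
  where
  head≡ : f zero ≡ g zero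
  head≡ = ≤-antisym (le zero) (+-cancelʳ-≤ (sum (g ∘ suc)) _ _
    (≤-trans (≤-reflexive (sym e)) (+-monoʳ-≤ (f zero) (sum-mono (le ∘ suc)))))
  pointwise : ∀ i → f i ≡ g i
  pointwise zero = head≡
  pointwise (suc i) = sum-mono-≡ (le ∘ suc)
    (+-cancelˡ-≡ (f zero) _ _ (trans e (cong (_+ sum (g ∘ suc)) (sym head≡)))) i

sum<⊎const : ∀ {n} (f : Fin n → ℕ) → (∀ i → f i ≤ 1) → sum f < n ⊎ (∀ i → f i ≡ 1)
sum<⊎const {zero} f le = inj₂ λ ()
sum<⊎const {suc n} f le with sum<⊎const (f ∘ suc) (le ∘ suc)
... | inj₁ lt = inj₁ (≤-trans (s≤s (+-monoˡ-≤ _ (le zero))) (s≤s lt))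
... | inj₂ e with f zero in eq
...   | zero = inj₁ (s≤s (≤-trans (sum-≤-const (f ∘ suc) 1 (le ∘ suc)) (≤-reflexive (*-identityʳ n))))
...   | suc zero = inj₂ λ { zero → eq ; (suc i) → e i }
...   | suc (suc x) with s≤s () ← subst (_≤ 1) eq (le zero)

sum-indicator-≟ : ∀ {n} (b : Fin n) → sum (λ a → indicator (a Fin.≟ b)) ≤ 1
sum-indicator-≟ {suc n} zero = s≤s (≤-trans (sum-≤-const {n} _ 0 (λ i → indicator-mono (suc i Fin.≟ zero) (no id) λ ())) (≤-reflexive (*-zeroʳ n)))
sum-indicator-≟ {suc n} (suc b) = +-mono-≤ (indicator-mono (zero Fin.≟ suc b) (no id) λ ())
  (≤-trans (sum-mono (λ a → indicator-mono (suc a Fin.≟ suc b) (a Fin.≟ b) Fin.suc-injective)) (sum-indicator-≟ b))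

subset-of-size : ∀ {n} (C : Subset n) k → k ≤ ∣ C ∣ → ∃[ B ] (B ⊆ˢ C × ∣ B ∣ ≡ k)
subset-of-size [] zero le = [] , id , refl
subset-of-size (outside ∷ C) k le with subset-of-size C k le
... | B , s , e = outside ∷ B , (λ { (there x) → there (s x) }) , e
subset-of-size (inside ∷ C) zero le with subset-of-size C zero z≤n
... | B , s , e = outside ∷ B , (λ { (there x) → there (s x) }) , e
subset-of-size (inside ∷ C) (suc k) (s≤s le) with subset-of-size C k le
... | B , s , e = inside ∷ B , (λ { here → here ; (there x) → there (s x) }) , cong suc e

∈-tabulate⁻ : ∀ {n} {P : Fin n → Set} (P? : ∀ i → Dec (P i)) i → i ∈ˢ tabulate (does ∘ P?) → P i
∈-tabulate⁻ P? i i∈ = witness (P? i) (trans (sym (lookup∘tabulate (does ∘ P?) i)) ([]=⇒lookup i∈))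
  where
  witness : (Q? : Dec Q) → does Q? ≡ true → Q
  witness (yes x) _ = x

∈-tabulate⁺ : ∀ {n} {P : Fin n → Set} (P? : ∀ i → Dec (P i)) i → P i → i ∈ˢ tabulate (does ∘ P?)
∈-tabulate⁺ P? i x = lookup⇒[]= i _ (trans (lookup∘tabulate (does ∘ P?) i) (dec-true (P? i) x))

∣tabulate∣ : ∀ {n} {P : Fin n → Set} (P? : ∀ i → Dec (P i)) → ∣ tabulate (does ∘ P?) ∣ ≡ sum (indicator ∘ P?)
∣tabulate∣ {zero} P? = refl
∣tabulate∣ {suc n} P? with P? zero
... | yes _ = cong suc (∣tabulate∣ (P? ∘ suc))
... | no _ = ∣tabulate∣ (P? ∘ suc)

-- Makes the existence of a family of sets decidable, so that the prime case can be argued by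
-- contradiction.
anyVec? : ∀ {A : Set} → (∀ {P : A → Set} → Decidable P → Dec (∃ P)) →
  ∀ n {P : Vec A n → Set} → Decidable P → Dec (∃ P)
anyVec? any zero P? = map′ ([] ,_) (λ { ([] , x) → x }) (P? [])
anyVec? any (suc n) P? = map′ (λ { (x , xs , y) → x ∷ xs , y }) (λ { (x ∷ xs , y) → x , xs , y })
  (any λ x → anyVec? any n λ xs → P? (x ∷ xs))

occurrences : ∀ {n} → Fin n → List (Fin n) → ℕ
occurrences i [] = 0
occurrences i (j ∷ l) = indicator (i Fin.≟ j) + occurrences i l

listWith : ∀ {n} → (Fin n → ℕ) → List (Fin n)
listWith {zero} w = []
listWith {suc n} w = replicate (w zero) zero ++ map suc (listWith (w ∘ suc))

length-listWith : ∀ {n} (w : Fin n → ℕ) → length (listWith w) ≡ sum w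
length-listWith {zero} w = refl
length-listWith {suc n} w = trans (length-++ (replicate (w zero) zero))
  (cong₂ _+_ (length-replicate (w zero)) (trans (length-map suc (listWith (w ∘ suc))) (length-listWith (w ∘ suc))))

occurrences-listWith : ∀ {n} (w : Fin n → ℕ) i → occurrences i (listWith w) ≤ w i
occurrences-listWith {suc n} w i = ≤-trans (≤-reflexive (++⁻ (replicate (w zero) zero))) (bound i)
  where
  ++⁻ : ∀ l {l′} → occurrences i (l ++ l′) ≡ occurrences i l + occurrences i l′
  ++⁻ [] = refl
  ++⁻ (j ∷ l) = trans (cong (indicator (i Fin.≟ j) +_) (++⁻ l)) (sym (+-assoc (indicator (i Fin.≟ j)) _ _))
  replicate-same : ∀ k → occurrences {suc n} zero (replicate k zero) ≤ k
  replicate-same zero = z≤n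
  replicate-same (suc k) = s≤s (replicate-same k)
  replicate-other : ∀ k (i : Fin n) → occurrences (suc i) (replicate k zero) ≡ 0
  replicate-other zero i = refl
  replicate-other (suc k) i = replicate-other k i
  map-zero : ∀ (l : List (Fin n)) → occurrences zero (map suc l) ≡ 0
  map-zero [] = refl
  map-zero (j ∷ l) = map-zero l
  map-suc : ∀ i (l : List (Fin n)) → occurrences (suc i) (map suc l) ≤ occurrences i l
  map-suc i [] = z≤n
  map-suc i (j ∷ l) = +-mono-≤ (indicator-mono (suc i Fin.≟ suc j) (i Fin.≟ j) Fin.suc-injective) (map-suc i l)
  bound : ∀ i → occurrences i (replicate (w zero) zero) + occurrences i (map suc (listWith (w ∘ suc))) ≤ w i
  bound zero rewrite map-zero (listWith (w ∘ suc)) = ≤-trans (≤-reflexive (+-identityʳ _)) (replicate-same (w zero))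
  bound (suc i) rewrite replicate-other (w zero) i = ≤-trans (map-suc i (listWith (w ∘ suc))) (occurrences-listWith (w ∘ suc) i)

prime-inverse : ∀ {p} → Prime p → ∀ c → 0 < c → c < p → ∃[ x ] ∃[ y ] (c * x ≡ 1 + p * y)
prime-inverse {p} pr c@(suc _) 0<c c<p with coprime-Bézout (prime⇒coprime pr c<p)
... | Bézout.-+ x y e = y , x , trans (*-comm c y) (trans (sym e) (cong suc (*-comm x p)))
prime-inverse {suc zero} pr (suc _) 0<c (s≤s ()) | Bézout.+- (suc x) y e
-- Here y c is -1 modulo p, and the factor p - 1 corrects the sign within the natural numbers.
prime-inverse {suc (suc k)} pr c@(suc _) 0<c c<p | Bézout.+- (suc x) y e =
  y * suc k , k + x * suc k , (begin
    c * (y * suc k)                       ≡⟨ regroup c y (suc k) ⟩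
    (y * c) * suc k                       ≡⟨ cong (_* suc k) (suc-injective e) ⟩
    (suc k + x * suc (suc k)) * suc k     ≡⟨ expand x k ⟩
    1 + suc (suc k) * (k + x * suc k)     ∎)
  where
  open ≡-Reasoning
  regroup : ∀ c y q → c * (y * q) ≡ (y * c) * q
  regroup = solve-∀
  expand : ∀ x k → (suc k + x * suc (suc k)) * suc k ≡ 1 + suc (suc k) * (k + x * suc k)
  expand = solve-∀

-- Equivariant means modulo a prime

module CyclicMean (q : ℕ) (prime : Prime (suc q)) where

  open CyclicGroup q

  sum-t : ∀ (h : G → ℕ) → sum (h ∘ t) ≡ sum h
  sum-t h = begin
    sum (h ∘ t)                                       ≡⟨ sum-init-last (h ∘ t) ⟩
    sum (λ b → h (t (inject₁ b))) + h (t (fromℕ q))   ≡⟨ cong₂ _+_ (sum-cong-≗ (λ b → cong h (t-inject₁ b))) (cong h t-last) ⟩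
    sum (h ∘ suc) + h zero                            ≡⟨ +-comm _ (h zero) ⟩
    sum h                                             ∎
    where open ≡-Reasoning

  sum-shift : ∀ {h h′ : G → ℕ} → (∀ a → h′ (t a) ≡ h a) → sum h′ ≡ sum h
  sum-shift {h} {h′} e = trans (sym (sum-t h′)) (sum-cong-≗ e)

  moment : (G → ℕ) → ℕ
  moment h = sum (λ a → toℕ a * h a)

  -- A shift adds 1 to every index, so the moment grows by `sum h`; the term with p accounts for the
  -- last index, which returns to zero.
  moment-t : ∀ {h h′ : G → ℕ} → (∀ a → h′ (t a) ≡ h a) → moment h′ + p * h (fromℕ q) ≡ moment h + sum h
  moment-t {h} {h′} e = begin
    moment h′ + p * h (fromℕ q)
      ≡⟨ cong (_+ p * h (fromℕ q)) (sum-t (λ a → toℕ a * h′ a)) ⟨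
    sum (λ a → toℕ (t a) * h′ (t a)) + p * h (fromℕ q)
      ≡⟨ cong (_+ p * h (fromℕ q)) (sum-cong-≗ (λ a → cong (toℕ (t a) *_) (e a))) ⟩
    sum (λ a → toℕ (t a) * h a) + p * h (fromℕ q)
      ≡⟨ cong (_+ p * h (fromℕ q)) (sum-init-last (λ a → toℕ (t a) * h a)) ⟩
    sum (λ b → toℕ (t (inject₁ b)) * h (inject₁ b)) + toℕ (t (fromℕ q)) * h (fromℕ q) + p * h (fromℕ q)
      ≡⟨ cong₂ (λ x y → x + toℕ y * h (fromℕ q) + p * h (fromℕ q))
           (sum-cong-≗ (λ b → cong (λ y → toℕ y * h (inject₁ b)) (t-inject₁ b))) t-last ⟩
    sum (λ b → suc (toℕ b) * h (inject₁ b)) + 0 + p * h (fromℕ q)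
      ≡⟨ cong (_+ p * h (fromℕ q)) (+-identityʳ (sum (λ b → suc (toℕ b) * h (inject₁ b)))) ⟩
    sum (λ b → suc (toℕ b) * h (inject₁ b)) + p * h (fromℕ q)
      ≡⟨ cong₂ (λ x y → x + suc y * h (fromℕ q))
           (sum-cong-≗ (λ b → cong (λ y → suc y * h (inject₁ b)) (Fin.toℕ-inject₁ b))) (Fin.toℕ-fromℕ q) ⟨
    sum (λ b → suc (toℕ (inject₁ b)) * h (inject₁ b)) + suc (toℕ (fromℕ q)) * h (fromℕ q)
      ≡⟨ sum-init-last (λ a → suc (toℕ a) * h a) ⟨
    sum (λ a → suc (toℕ a) * h a)
      ≡⟨ ∑-distrib-+ h (λ a → toℕ a * h a) ⟩
    sum h + moment h
      ≡⟨ +-comm (sum h) (moment h) ⟩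
    moment h + sum h ∎
    where open ≡-Reasoning

  Proper : ℕ → Set
  Proper c = 0 < c × c < p

  proper? : ∀ c → Dec (Proper c)
  proper? c = (0 <? c) ×-dec (c <? p)

  inverse : ℕ → ℕ
  inverse c with proper? c
  ... | yes (0<c , c<p) = proj₁ (prime-inverse prime c 0<c c<p)
  ... | no _ = 0

  inverse-correct : ∀ c → Proper c → ∃[ y ] (c * inverse c ≡ 1 + p * y)
  inverse-correct c P with proper? c
  ... | yes (0<c , c<p) = proj₂ (prime-inverse prime c 0<c c<p)
  ... | no ¬P = ⊥-elim (¬P P)

  -- The mean of h in ℤ/p; this is where primality enters.
  mean : (G → ℕ) → G
  mean h = iterate (inverse (sum h) * moment h) t zero

  mean-cong : ∀ {h h′} → h ≗ h′ → mean h ≡ mean h′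
  mean-cong e = cong₂ (λ c m → iterate (inverse c * m) t zero) (sum-cong-≗ e) (sum-cong-≗ (λ a → cong (toℕ a *_) (e a)))

  iterate-mod : ∀ x y a → iterate (x + p * y) t a ≡ iterate x t a
  iterate-mod x zero a = cong (λ j → iterate j t a) (trans (cong (x +_) (*-zeroʳ p)) (+-identityʳ x))
  iterate-mod x (suc y) a = begin
    iterate (x + p * suc y) t a        ≡⟨ cong (λ j → iterate j t a) (lemma x q y) ⟩
    iterate ((x + p * y) + p) t a      ≡⟨ iterate-+ (x + p * y) p t a ⟩
    iterate p t (iterate (x + p * y) t a) ≡⟨ iterate-p _ ⟩
    iterate (x + p * y) t a            ≡⟨ iterate-mod x y a ⟩
    iterate x t a                      ∎
    where
    open ≡-Reasoning
    lemma : ∀ x q y → x + suc q * suc y ≡ (x + suc q * y) + suc q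
    lemma = solve-∀

  -- Modulo p the shift adds `sum h` to the moment, and the inverse of `sum h` turns this into a
  -- single step of `t`.
  mean-t : ∀ {h h′ : G → ℕ} → (∀ a → h′ (t a) ≡ h a) → Proper (sum h) → mean h′ ≡ t (mean h)
  mean-t {h} {h′} e P = begin
    iterate (inverse (sum h′) * moment h′) t zero      ≡⟨ cong (λ c → iterate (inverse c * moment h′) t zero) (sum-shift {h} {h′} e) ⟩
    iterate (i * moment h′) t zero                     ≡⟨ iterate-mod (i * moment h′) (i * x) zero ⟨
    iterate (i * moment h′ + p * (i * x)) t zero       ≡⟨ cong (λ j → iterate j t zero) exponents ⟩
    iterate (suc (i * moment h) + p * y) t zero        ≡⟨ iterate-mod (suc (i * moment h)) y zero ⟩
    iterate (suc (i * moment h)) t zero                ≡⟨ iterate-suc (i * moment h) t zero ⟩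
    t (mean h)                                         ∎
    where
    open ≡-Reasoning
    i = inverse (sum h)
    x = h (fromℕ q)
    y = proj₁ (inverse-correct (sum h) P)
    factor : ∀ i m p x → i * m + p * (i * x) ≡ i * (m + p * x)
    factor = solve-∀
    split : ∀ i m s → i * (m + s) ≡ i * m + s * i
    split = solve-∀
    exponents : i * moment h′ + p * (i * x) ≡ suc (i * moment h) + p * y
    exponents = begin
      i * moment h′ + p * (i * x)     ≡⟨ factor i (moment h′) p x ⟩
      i * (moment h′ + p * x)         ≡⟨ cong (i *_) (moment-t {h} {h′} e) ⟩
      i * (moment h + sum h)          ≡⟨ split i (moment h) (sum h) ⟩
      i * moment h + sum h * i        ≡⟨ cong (i * moment h +_) (proj₂ (inverse-correct (sum h) P)) ⟩
      i * moment h + suc (p * y)      ≡⟨ +-suc (i * moment h) (p * y) ⟩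
      suc (i * moment h) + p * y      ∎

-- The prime case for sets

module PrimeSets (q : ℕ) (prime : Prime (suc q)) (n k m : ℕ) (w : Fin n → ℕ) (w<p : ∀ i → w i < suc q)
  (c : Subset n → ℕ) (c<m : ∀ B → ∣ B ∣ ≡ suc k → (∀ i → i ∈ˢ B → 0 < w i) → c B < m) where

  open CyclicGroup q
  open CyclicMean q prime

  V = Fin n × G

  open DecMembership (≡-dec (Fin._≟_ {n}) (Fin._≟_ {p})) using () renaming (_∈?_ to _∈ᵛ?_)

  Solution : Vec (Subset n) p → Set
  Solution As = (∀ a → ∣ lookup As a ∣ ≡ suc k × c (lookup As a) ≡ c (lookup As zero))
              × (∀ i → sum (λ a → indicator (i ∈? lookup As a)) ≤ w i)

  solution? : Dec (∃ Solution)
  solution? = anyVec? anySubset? p λ As →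
    Fin.all? (λ a → (∣ lookup As a ∣ ≟ suc k) ×-dec (c (lookup As a) ≟ c (lookup As zero)))
    ×-dec Fin.all? (λ i → sum (λ a → indicator (i ∈? lookup As a)) ≤? w i)

  row : Fin n → List V → G → ℕ
  row i u a = indicator ((i , a) ∈ᵛ? u)

  column : List V → G → Subset n
  column u a = tabulate (λ i → does ((i , a) ∈ᵛ? u))

  ∈-column⁻ : ∀ u a i → i ∈ˢ column u a → (i , a) ∈ u
  ∈-column⁻ u a = ∈-tabulate⁻ (λ i → (i , a) ∈ᵛ? u)

  ∈-column⁺ : ∀ u a i → (i , a) ∈ u → i ∈ˢ column u a
  ∈-column⁺ u a = ∈-tabulate⁺ (λ i → (i , a) ∈ᵛ? u)

  HasColour : ℕ → Subset n → Set
  HasColour γ C = ∃[ B ] (B ⊆ˢ C × ∣ B ∣ ≡ suc k × c B ≡ γ)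

  hasColour? : ∀ γ C → Dec (HasColour γ C)
  hasColour? γ C = anySubset? λ B → (B ⊆? C) ×-dec (∣ B ∣ ≟ suc k) ×-dec (c B ≟ γ)

  carriers : ℕ → List V → G → ℕ
  carriers γ u a = indicator (hasColour? γ (column u a))

  t-injective : ∀ {a b} → t a ≡ t b → a ≡ b
  t-injective {a} {b} e = trans (sym (iterate-p a)) (trans (cong (iterate q t) e) (iterate-p b))

  τ : V → V
  τ = map₂ t

  ∈-τ⁻ : ∀ {i a} u → (i , t a) ∈ map τ u → (i , a) ∈ u
  ∈-τ⁻ u x with ∈-map⁻ τ x
  ... | (j , b) , y , e = subst (_∈ u) (sym (cong₂ _,_ (cong proj₁ e) (t-injective (cong proj₂ e)))) y

  row-τ : ∀ i u a → row i (map τ u) (t a) ≡ row i u a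
  row-τ i u a = indicator-cong ((i , t a) ∈ᵛ? map τ u) ((i , a) ∈ᵛ? u) (∈-τ⁻ u) (∈-map⁺ τ)

  column-τ : ∀ u a → column (map τ u) (t a) ≡ column u a
  column-τ u a = tabulate-cong λ i →
    does-⇔ (mk⇔ (∈-τ⁻ u) (∈-map⁺ τ)) ((i , t a) ∈ᵛ? map τ u) ((i , a) ∈ᵛ? u)

  carriers-τ : ∀ γ u a → carriers γ (map τ u) (t a) ≡ carriers γ u a
  carriers-τ γ u a = cong (λ C → indicator (hasColour? γ C)) (column-τ u a)

  row-mono : ∀ {u v} → v ⊆ u → ∀ i a → row i v a ≤ row i u a
  row-mono {u} {v} s i a = indicator-mono ((i , a) ∈ᵛ? v) ((i , a) ∈ᵛ? u) (⊆-lookup s)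

  carriers-mono : ∀ {u v} → v ⊆ u → ∀ γ a → carriers γ v a ≤ carriers γ u a
  carriers-mono {u} {v} s γ a = indicator-mono (hasColour? γ (column v a)) (hasColour? γ (column u a))
    λ { (B , B⊆ , rest) → B , (λ {i} i∈ → ∈-column⁺ u a i (⊆-lookup s (∈-column⁻ v a i (B⊆ i∈)))) , rest }

  -- Entries are counted with repetition: the condition then depends on the first coordinates alone,
  -- which are the same for all tuples in the cone chain.
  Admissible : List V → Set
  Admissible u = ∀ i → occurrences i (map proj₁ u) ≤ w i

  admissible-⊆ : ∀ {u v} → v ⊆ u → Admissible u → Admissible v
  admissible-⊆ s X i = ≤-trans (mono s) (X i)
    where
    mono : ∀ {u v} → v ⊆ u → occurrences i (map proj₁ v) ≤ occurrences i (map proj₁ u)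
    mono [] = z≤n
    mono (y ∷ʳ s) = ≤-trans (mono s) (m≤n+m _ (indicator (i Fin.≟ proj₁ y)))
    mono (refl ∷ s) = +-monoʳ-≤ _ (mono s)

  sum-row≤occurrences : ∀ i u → sum (row i u) ≤ occurrences i (map proj₁ u)
  sum-row≤occurrences i [] = ≤-trans (sum-≤-const (row i []) 0 (λ _ → z≤n)) (≤-reflexive (*-zeroʳ p))
  sum-row≤occurrences i ((j , b) ∷ u) = begin
    sum (row i ((j , b) ∷ u))
      ≤⟨ sum-mono pointwise ⟩
    sum (λ a → indicator (i Fin.≟ j) * indicator (a Fin.≟ b) + row i u a)
      ≡⟨ ∑-distrib-+ (λ a → indicator (i Fin.≟ j) * indicator (a Fin.≟ b)) (row i u) ⟩
    sum (λ a → indicator (i Fin.≟ j) * indicator (a Fin.≟ b)) + sum (row i u)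
      ≤⟨ +-mono-≤ single (sum-row≤occurrences i u) ⟩
    indicator (i Fin.≟ j) + occurrences i (map proj₁ u) ∎
    where
    open ≤-Reasoning
    pointwise : ∀ a → row i ((j , b) ∷ u) a ≤ indicator (i Fin.≟ j) * indicator (a Fin.≟ b) + row i u a
    pointwise a with (i , a) ∈ᵛ? ((j , b) ∷ u)
    ... | no _ = z≤n
    ... | yes (here refl) rewrite indicator-true (i Fin.≟ i) refl | indicator-true (a Fin.≟ a) refl = s≤s z≤n
    ... | yes (there x) rewrite indicator-true ((i , a) ∈ᵛ? u) x = m≤n+m 1 _
    single : sum (λ a → indicator (i Fin.≟ j) * indicator (a Fin.≟ b)) ≤ indicator (i Fin.≟ j)
    single with i Fin.≟ j
    ... | no _ = ≤-trans (sum-≤-const {p} (λ _ → 0) 0 (λ _ → z≤n)) (≤-reflexive (*-zeroʳ p))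
    ... | yes _ = ≤-trans (≤-reflexive (sum-cong-≗ (λ a → *-identityˡ (indicator (a Fin.≟ b))))) (sum-indicator-≟ b)

  sum-row≤w : ∀ i u → Admissible u → sum (row i u) ≤ w i
  sum-row≤w i u X = ≤-trans (sum-row≤occurrences i u) (X i)

  -- The clauses for [] make the sign equivariant on all nonempty lists; admissible ones never reach them.
  rowSign : List (Fin n) → List V → G
  rowSign [] [] = zero
  rowSign [] ((i , a) ∷ u) = a
  rowSign (i ∷ is) u with proper? (sum (row i u))
  ... | yes _ = mean (row i u)
  ... | no _ = rowSign is u

  size : List V → ℕ
  size u = sum (λ i → sum (row i u))

  -- The sign, and a potential that grows whenever the sign changes along a flag.
  state : ℕ → List V → G × ℕ
  state zero u = rowSign (allFin n) u , size u
  state (suc γ) u with proper? (sum (carriers γ u))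
  ... | yes _ = mean (carriers γ u) , p * k + γ * q + sum (carriers γ u)
  ... | no _ = state γ u

  σ : List V → G
  σ = proj₁ ∘ state m

  φ : List V → ℕ
  φ = proj₂ ∘ state m

  sum-row-τ : ∀ i u → sum (row i (map τ u)) ≡ sum (row i u)
  sum-row-τ i u = sum-shift {row i u} {row i (map τ u)} (row-τ i u)

  sum-carriers-τ : ∀ γ u → sum (carriers γ (map τ u)) ≡ sum (carriers γ u)
  sum-carriers-τ γ u = sum-shift {carriers γ u} {carriers γ (map τ u)} (carriers-τ γ u)

  rowSign-τ : ∀ is x u → rowSign is (map τ (x ∷ u)) ≡ t (rowSign is (x ∷ u))
  rowSign-τ [] x u = refl
  rowSign-τ (i ∷ is) x u with proper? (sum (row i (map τ (x ∷ u)))) | proper? (sum (row i (x ∷ u)))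
  ... | yes _ | yes P = mean-t {row i (x ∷ u)} {row i (map τ (x ∷ u))} (row-τ i (x ∷ u)) P
  ... | yes P | no ¬P = ⊥-elim (¬P (subst Proper (sum-row-τ i (x ∷ u)) P))
  ... | no ¬P | yes P = ⊥-elim (¬P (subst Proper (sym (sum-row-τ i (x ∷ u))) P))
  ... | no _ | no _ = rowSign-τ is x u

  state-τ : ∀ γ x u → proj₁ (state γ (map τ (x ∷ u))) ≡ t (proj₁ (state γ (x ∷ u)))
  state-τ zero x u = rowSign-τ (allFin n) x u
  state-τ (suc γ) x u with proper? (sum (carriers γ (map τ (x ∷ u)))) | proper? (sum (carriers γ (x ∷ u)))
  ... | yes _ | yes P = mean-t {carriers γ (x ∷ u)} {carriers γ (map τ (x ∷ u))} (carriers-τ γ (x ∷ u)) P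
  ... | yes P | no ¬P = ⊥-elim (¬P (subst Proper (sum-carriers-τ γ (x ∷ u)) P))
  ... | no ¬P | yes P = ⊥-elim (¬P (subst Proper (sym (sum-carriers-τ γ (x ∷ u))) P))
  ... | no _ | no _ = state-τ γ x u

  rowSign-cong : ∀ {u v} → (∀ i → row i v ≗ row i u) → ∀ {i is} → i ∈ is → Proper (sum (row i u)) →
    rowSign is v ≡ rowSign is u
  rowSign-cong {u} {v} e {i} {j ∷ is} i∈ P
    with proper? (sum (row j v)) | proper? (sum (row j u))
  ... | yes _ | yes _ = mean-cong (e j)
  ... | yes Q | no ¬Q = ⊥-elim (¬Q (subst Proper (sum-cong-≗ (e j)) Q))
  ... | no ¬Q | yes Q = ⊥-elim (¬Q (subst Proper (sym (sum-cong-≗ (e j))) Q))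
  rowSign-cong e (here refl) P | no _ | no ¬Q = ⊥-elim (¬Q P)
  rowSign-cong e (there i∈) P | no _ | no _ = rowSign-cong e i∈ P

  sum-row-positive : ∀ i a u → (i , a) ∈ u → 0 < sum (row i u)
  sum-row-positive i a u x =
    ≤-trans (≤-reflexive (sym (indicator-true ((i , a) ∈ᵛ? u) x))) (term≤sum (row i u) a)

  state-positive : ∀ γ x u → 0 < proj₂ (state γ (x ∷ u))
  state-positive zero (i , a) u =
    ≤-trans (sum-row-positive i a ((i , a) ∷ u) (here refl)) (term≤sum (λ j → sum (row j ((i , a) ∷ u))) i)
  state-positive (suc γ) x u with proper? (sum (carriers γ (x ∷ u)))
  ... | yes (0<s , _) = ≤-trans 0<s (m≤n+m _ (p * k + γ * q))
  ... | no _ = state-positive γ x u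

  module _ (unsolvable : ¬ ∃ Solution) where

    -- If all p columns contained a set of colour `γ`, these sets would form a solution, as
    -- admissibility bounds the multiplicity of each point.
    carriers<p : ∀ γ u → Admissible u → sum (carriers γ u) < p
    carriers<p γ u X with sum<⊎const (carriers γ u) (λ a → indicator≤1 (hasColour? γ (column u a)))
    ... | inj₁ lt = lt
    ... | inj₂ full = ⊥-elim (unsolvable (tabulate B , colours , multiplicities))
      where
      witness : ∀ a → HasColour γ (column u a)
      witness a = indicator-witness (hasColour? γ (column u a)) (full a)
      B : G → Subset n
      B a = proj₁ (witness a)
      B≡ : ∀ a → lookup (tabulate B) a ≡ B a
      B≡ = lookup∘tabulate B
      colour : ∀ a → c (lookup (tabulate B) a) ≡ γ
      colour a = trans (cong c (B≡ a)) (proj₂ (proj₂ (proj₂ (witness a))))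
      colours : ∀ a → ∣ lookup (tabulate B) a ∣ ≡ suc k × c (lookup (tabulate B) a) ≡ c (lookup (tabulate B) zero)
      colours a = trans (cong ∣_∣ (B≡ a)) (proj₁ (proj₂ (proj₂ (witness a)))) , trans (colour a) (sym (colour zero))
      multiplicities : ∀ i → sum (λ a → indicator (i ∈? lookup (tabulate B) a)) ≤ w i
      multiplicities i = ≤-trans (sum-mono (λ a → indicator-mono (i ∈? lookup (tabulate B) a) ((i , a) ∈ᵛ? u)
        (λ i∈ → ∈-column⁻ u a i (proj₁ (proj₂ (witness a)) (subst (i ∈ˢ_) (B≡ a) i∈))))) (sum-row≤w i u X)

    -- The invariant of the descent in `state`: the colours from `γ` up to `m` have been passed
    -- without finding a carrier.
    NoColourFrom : ℕ → List V → Set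
    NoColourFrom γ u = ∀ γ′ → γ ≤ γ′ → γ′ < m → sum (carriers γ′ u) ≡ 0

    noColour-step : ∀ γ u → Admissible u → ¬ Proper (sum (carriers γ u)) → NoColourFrom (suc γ) u → NoColourFrom γ u
    noColour-step γ u X ¬P H γ′ le lt with m≤n⇒m<n∨m≡n le
    ... | inj₁ γ<γ′ = H γ′ γ<γ′ lt
    ... | inj₂ refl = n≤0⇒n≡0 (≮⇒≥ λ 0<s → ¬P (0<s , carriers<p γ u X))

    noColour-⊆ : ∀ γ {u v} → v ⊆ u → NoColourFrom γ u → NoColourFrom γ v
    noColour-⊆ γ s H γ′ le lt = n≤0⇒n≡0 (≤-trans (sum-mono (carriers-mono s γ′)) (≤-reflexive (H γ′ le lt)))

    -- A column with more than k points would contain a set of size k + 1, and its colour, being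
    -- below `m`, would have a carrier.
    size≤pk : ∀ u → Admissible u → NoColourFrom 0 u → size u ≤ p * k
    size≤pk u X H = begin
      sum (λ i → sum (λ a → row i u a))   ≡⟨ ∑-comm (λ i a → row i u a) ⟩
      sum (λ a → sum (λ i → row i u a))   ≤⟨ sum-≤-const (λ a → sum (λ i → row i u a)) k column≤k ⟩
      p * k                               ∎
      where
      open ≤-Reasoning
      column≤k : ∀ a → sum (λ i → row i u a) ≤ k
      column≤k a = ≮⇒≥ λ k< → absurd (subset-of-size (column u a) (suc k)
        (≤-trans k< (≤-reflexive (sym (∣tabulate∣ (λ i → (i , a) ∈ᵛ? u))))))
        where
        absurd : ∃[ B ] (B ⊆ˢ column u a × ∣ B ∣ ≡ suc k) → ⊥
        absurd (B , B⊆ , e) = <-irrefl refl (begin-strict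
          0                           <⟨ z<s ⟩
          1                           ≡⟨ indicator-true (hasColour? (c B) (column u a)) (B , B⊆ , e , refl) ⟨
          carriers (c B) u a          ≤⟨ term≤sum (carriers (c B) u) a ⟩
          sum (carriers (c B) u)      ≡⟨ H (c B) z≤n (c<m B e λ i i∈ →
            ≤-trans (sum-row-positive i a u (∈-column⁻ u a i (B⊆ i∈))) (sum-row≤w i u X)) ⟩
          0                           ∎)

    -- A proper number of carriers is at most q, so each colour occupies a band of width q above the
    -- bound p k for families without colours.
    state≤ : ∀ γ u → Admissible u → NoColourFrom γ u → proj₂ (state γ u) ≤ p * k + γ * q
    state≤ zero u X H = ≤-trans (size≤pk u X H) (m≤m+n _ 0)
    state≤ (suc γ) u X H with proper? (sum (carriers γ u))
    ... | yes (_ , s≤s le) = ≤-trans (+-monoʳ-≤ (p * k + γ * q) le)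
      (≤-reflexive (trans (+-assoc (p * k) (γ * q) q) (cong (p * k +_) (+-comm (γ * q) q))))
    ... | no ¬P = ≤-trans (state≤ γ u X (noColour-step γ u X ¬P H)) (+-monoʳ-≤ (p * k) (m≤n+m (γ * q) q))

    compare-sums : ∀ {h h′ : G → ℕ} → (∀ a → h a ≤ h′ a) → sum h < sum h′ ⊎ h ≗ h′
    compare-sums le with m≤n⇒m<n∨m≡n (sum-mono le)
    ... | inj₁ lt = inj₁ lt
    ... | inj₂ e = inj₂ (sum-mono-≡ le e)

    -- If both families stop at the same colour, the index set grows or stays the same, and so does
    -- the mean in the latter case. A colour present in `v` persists in `u`; a colour new in `u`
    -- lifts the potential above the band that bounds `v`.
    state-⊆ : ∀ γ {u v} → v ⊆ u → Admissible u → NoColourFrom γ u →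
      proj₂ (state γ v) < proj₂ (state γ u) ⊎ proj₁ (state γ v) ≡ proj₁ (state γ u)
    state-⊆ zero {[]} [] X H = inj₂ refl
    state-⊆ zero {u@((i , a) ∷ _)} s X H with m≤n⇒m<n∨m≡n (sum-mono (λ i → sum-mono (row-mono s i)))
    ... | inj₁ lt = inj₁ lt
    -- Equal sizes force equal rows, and the row of the first entry of `u` is proper since its sum
    -- is at most `w i`, hence below p.
    ... | inj₂ e = inj₂ (rowSign-cong
      (λ j → sum-mono-≡ (row-mono s j) (sum-mono-≡ (λ i → sum-mono (row-mono s i)) e j))
      (∈-allFin i) (sum-row-positive i a u (here refl) , ≤-<-trans (sum-row≤w i u X) (w<p i)))
    state-⊆ (suc γ) {u} {v} s X H with proper? (sum (carriers γ v)) | proper? (sum (carriers γ u))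
    ... | yes _ | yes _ with compare-sums (carriers-mono s γ)
    ...   | inj₁ lt = inj₁ (+-monoʳ-< (p * k + γ * q) lt)
    ...   | inj₂ e = inj₂ (mean-cong e)
    state-⊆ (suc γ) {u} {v} s X H | yes (0<s , _) | no ¬P =
      ⊥-elim (¬P (≤-trans 0<s (sum-mono (carriers-mono s γ)) , carriers<p γ u X))
    state-⊆ (suc γ) {u} {v} s X H | no ¬P | yes (0<s , _) = inj₁ (begin-strict
      proj₂ (state γ v)                       ≤⟨ state≤ γ v Xv (noColour-step γ v Xv ¬P (noColour-⊆ (suc γ) s H)) ⟩
      p * k + γ * q                           <⟨ m<m+n (p * k + γ * q) 0<s ⟩
      p * k + γ * q + sum (carriers γ u)      ∎)
      where
      open ≤-Reasoning
      Xv = admissible-⊆ s X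
    state-⊆ (suc γ) {u} {v} s X H | no _ | no ¬P = state-⊆ γ s X (noColour-step γ u X ¬P H)

    noColourFrom-m : ∀ u → NoColourFrom m u
    noColourFrom-m u γ′ m≤γ′ γ′<m = ⊥-elim (<-irrefl refl (≤-<-trans m≤γ′ γ′<m))

    -- For a larger `sum w`, every tuple over `listWith w` would have potential below its length,
    -- which `long-flag` excludes.
    few-points : sum w ≤ p * k + m * q
    few-points = ≮⇒≥ λ lt → long-flag Admissible admissible-⊆ φ
      (λ x u _ → state-positive m x u)
      (λ {u} s X → state-⊆ m s X (noColourFrom-m u))
      (prime⇒2≤ prime) (listWith w)
      λ u e → let X = λ i → ≤-trans (≤-reflexive (cong (occurrences i) e)) (occurrences-listWith w i) in
        X , ≤-<-trans (state≤ m u X (noColourFrom-m u)) (≤-trans lt (≤-reflexive (sym (length-listWith w))))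
      where
      open Signs σ (state-τ m)
      prime⇒2≤ : ∀ {p} → Prime p → 2 ≤ p
      prime⇒2≤ {p} pr = nonTrivial⇒n>1 p ⦃ prime⇒nonTrivial pr ⦄

  solution : p * k + m * q < sum w → ∃ Solution
  solution lt with solution?
  ... | yes s = s
  ... | no ¬s = ⊥-elim (<-irrefl refl (<-≤-trans lt (few-points ¬s)))

-- Families of vectors and multiplicativity in r

total : List (Vec ℕ n) → Fin n → ℕ
total [] i = 0
total (v ∷ L) i = lookup v i + total L i

total-++ : ∀ (L L′ : List (Vec ℕ n)) i → total (L ++ L′) i ≡ total L i + total L′ i
total-++ [] L′ i = refl
total-++ (v ∷ L) L′ i = trans (cong (lookup v i +_) (total-++ L L′ i)) (sym (+-assoc (lookup v i) _ _))

total-replicate : ∀ r (v : Vec ℕ n) i → total (List.replicate r v) i ≡ r * lookup v i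
total-replicate zero v i = refl
total-replicate (suc r) v i = cong (lookup v i +_) (total-replicate r v i)

total-tabulate : ∀ {r} (f : Fin r → Vec ℕ n) i → total (List.tabulate f) i ≡ sum (λ a → lookup (f a) i)
total-tabulate {r = zero} f i = refl
total-tabulate {r = suc r} f i = cong (lookup (f zero) i +_) (total-tabulate (f ∘ suc) i)

total-lookup : ∀ (L : List (Vec ℕ n)) i → total L i ≡ sum (λ a → lookup (List.lookup L a) i)
total-lookup [] i = refl
total-lookup (v ∷ L) i = cong (lookup v i +_) (total-lookup L i)

_InBox_ : Vec ℕ n → (Fin n → ℕ) → Set
v InBox u = ∀ i → lookup v i ≤ u i

vector-of-size : ∀ (w : Fin n → ℕ) k → k ≤ sum w → ∃[ v ] (v InBox w × sum (lookup v) ≡ k)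
vector-of-size {zero} w k le = [] , (λ ()) , sym (n≤0⇒n≡0 le)
vector-of-size {suc n} w k le with vector-of-size (w ∘ suc) (k ∸ w zero) (m≤n+o⇒m∸n≤o k (w zero) le)
... | v , v≤ , e = w zero ⊓ k ∷ v , (λ { zero → m⊓n≤m (w zero) k ; (suc i) → v≤ i }) ,
  trans (cong (w zero ⊓ k +_) e) (m⊓n+n∸m≡n (w zero) k)

record Monochromatic (r k m : ℕ) (u w : Fin n → ℕ) (c : Vec ℕ n → ℕ) : Set where
  constructor monochromatic
  field
    colour : ℕ
    colour<m : colour < m
    vectors : List (Vec ℕ n)
    length≡ : length vectors ≡ r
    each : All (λ v → v InBox u × sum (lookup v) ≡ suc k × c v ≡ colour) vectors
    total≤ : ∀ i → total vectors i ≤ w i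

-- The theorem for vectors of size k + 1 below u in place of (k + 1)-sets. The inequality reads
-- m (r − 1) + r k < ∑ w for r ≥ 1.
Property : ℕ → Set
Property r = ∀ {n} k m (u w : Fin n → ℕ) → (∀ i → w i ≤ r * u i) → r * (m + k) < sum w + m →
  (c : Vec ℕ n → ℕ) → (∀ v → v InBox u → sum (lookup v) ≡ suc k → c v < m) → Monochromatic r k m u w c

property-1 : Property 1
property-1 k m u w w≤u big c c<m with vector-of-size w (suc k) k<
  where
  k< : k < sum w
  k< = +-cancelʳ-< m k (sum w) (subst (_< sum w + m) (trans (+-identityʳ (m + k)) (+-comm m k)) big)
... | v , v≤w , e = monochromatic (c v) (c<m v v≤u e) (v ∷ []) refl ((v≤u , e , refl) ∷ [])
  λ i → ≤-trans (≤-reflexive (+-identityʳ _)) (v≤w i)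
  where
  v≤u : v InBox u
  v≤u i = ≤-trans (v≤w i) (≤-trans (w≤u i) (≤-reflexive (+-identityʳ (u i))))

property-* : ∀ a b → .{{NonZero a}} → Property a → Property b → Property (a * b)
property-* a@(suc a′) b inner outer {n} k m u w w≤ big c c<m = result
  where
  -- `suc K` is the least size allowed by the inequality for `a`, as a (m + k) = K + m. Hence b (m +
  -- K) = a b (m + k), and the hypothesis for `a * b` is exactly the one needed for `b`.
  K = k + a′ * (m + k)
  U : Fin n → ℕ
  U i = a * u i

  Valid : Vec ℕ n → Set
  Valid V = V InBox U × sum (lookup V) ≡ suc K

  valid? : ∀ V → Dec (Valid V)
  valid? V = Fin.all? (λ i → lookup V i ≤? U i) ×-dec (sum (lookup V) ≟ suc K)

  solve : ∀ V → Valid V → Monochromatic a k m u (lookup V) c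
  solve V (V≤ , e) = inner k m u (lookup V) V≤ large c c<m
    where
    size : ∀ m k a′ → suc a′ * (m + k) ≡ (k + a′ * (m + k)) + m
    size = solve-∀
    large : a * (m + k) < sum (lookup V) + m
    large = ≤-reflexive (trans (cong suc (size m k a′)) (cong (_+ m) (sym e)))

  C : Vec ℕ n → ℕ
  C V with valid? V
  ... | yes valid = Monochromatic.colour (solve V valid)
  -- A default value; all vectors returned by the case `b` are valid.
  ... | no _ = 0

  C<m : ∀ V → V InBox U → sum (lookup V) ≡ suc K → C V < m
  C<m V V≤ e with valid? V
  ... | yes valid = Monochromatic.colour<m (solve V valid)
  ... | no invalid = ⊥-elim (invalid (V≤ , e))

  Good : ℕ → Vec ℕ n → Set
  Good γ v = v InBox u × sum (lookup v) ≡ suc k × c v ≡ γ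

  split : ∀ γ V → V InBox U × sum (lookup V) ≡ suc K × C V ≡ γ →
    ∃[ L ] (length L ≡ a × All (Good γ) L × (∀ i → total L i ≤ lookup V i))
  split γ V (V≤ , e , C≡) with valid? V
  ... | no invalid = ⊥-elim (invalid (V≤ , e))
  split _ V (V≤ , e , refl) | yes valid = vectors , length≡ , each , total≤
    where open Monochromatic (solve V valid)

  flatten : ∀ γ Vs → All (λ V → V InBox U × sum (lookup V) ≡ suc K × C V ≡ γ) Vs →
    ∃[ L ] (length L ≡ a * length Vs × All (Good γ) L × (∀ i → total L i ≤ total Vs i))
  flatten γ [] [] = [] , sym (*-zeroʳ a) , [] , λ _ → z≤n
  flatten γ (V ∷ Vs) (g ∷ gs) with split γ V g | flatten γ Vs gs
  ... | L , e , good , le | L′ , e′ , good′ , le′ =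
    L ++ L′ , trans (length-++ L) (trans (cong₂ _+_ e e′) (sym (*-suc a (length Vs)))) , All.++⁺ good good′ ,
    λ i → ≤-trans (≤-reflexive (total-++ L L′ i)) (+-mono-≤ (le i) (le′ i))

  outerResult : Monochromatic b K m U w C
  outerResult = outer K m U w
    (λ i → ≤-trans (w≤ i) (≤-reflexive (regroup a b (u i))))
    (subst (_< sum w + m) (size a′ b m k) big) C C<m
    where
    regroup : ∀ a b x → a * b * x ≡ b * (a * x)
    regroup = solve-∀
    size : ∀ a′ b m k → suc a′ * b * (m + k) ≡ b * (m + (k + a′ * (m + k)))
    size = solve-∀

  result : Monochromatic (a * b) k m u w c
  result = let
      open Monochromatic outerResult
      L , e , good , le = flatten colour vectors each
    in monochromatic colour colour<m L (trans e (cong (a *_) length≡)) good (λ i → ≤-trans (le i) (total≤ i))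

-- From sets to vectors for a prime

∣∣≡sum : ∀ (B : Subset n) → ∣ B ∣ ≡ sum (λ i → indicator (i ∈? B))
∣∣≡sum [] = refl
∣∣≡sum (b ∷ B) = trans (cons b) (cong (indicator (zero ∈? b ∷ B) +_) (sum-cong-≗ λ i →
  indicator-cong (i ∈? B) (suc i ∈? b ∷ B) there drop-there))
  where
  cons : ∀ b → ∣ b ∷ B ∣ ≡ indicator (zero ∈? b ∷ B) + sum (λ i → indicator (i ∈? B))
  cons inside = cong suc (∣∣≡sum B)
  cons outside = ∣∣≡sum B

sum-*ʳ : ∀ (f : Fin n → ℕ) x → sum (λ i → f i * x) ≡ sum f * x
sum-*ʳ {zero} f x = refl
sum-*ʳ {suc n} f x = trans (cong (f zero * x +_) (sum-*ʳ (f ∘ suc) x)) (sym (*-distribʳ-+ x (f zero) _))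

sum-const : ∀ r x → sum {r} (λ _ → x) ≡ r * x
sum-const zero x = refl
sum-const (suc r) x = cong (x +_) (sum-const r x)

-- Writing w = ρ + base p with ρ < p, the vector base may be put into all p vectors; what remains are sets.
property-prime : ∀ p → Prime p → Property p
property-prime p@(suc q) pr {n} k m u w w≤ big c c<m with suc k ≤? sum (λ i → w i / p)
... | yes k<base with vector-of-size (λ i → w i / p) (suc k) k<base
...   | v , v≤ , e = monochromatic (c v) (c<m v v≤u e) (List.replicate p v) (length-replicate p)
  (All.replicate⁺ p (v≤u , e , refl))
  λ i → ≤-trans (≤-reflexive (total-replicate p v i))
    (≤-trans (*-monoʳ-≤ p (v≤ i)) (≤-trans (≤-reflexive (*-comm p (w i / p))) (m/n*n≤m (w i) p)))
  where
  v≤u : v InBox u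
  v≤u i = ≤-trans (v≤ i) (*-cancelˡ-≤ p (≤-trans (≤-reflexive (*-comm p (w i / p))) (≤-trans (m/n*n≤m (w i) p) (w≤ i))))
property-prime p@(suc q) pr {n} k m u w w≤ big c c<m | no k≮base = result
  where
  base ρ : Fin n → ℕ
  base i = w i / p
  ρ i = w i % p

  -- The base already supplies `sum base` of the k + 1 units; this is at most k here, so the
  -- subtraction is exact.
  k′ = k ∸ sum base

  k≡ : k ≡ sum base + k′
  k≡ = sym (m+[n∸m]≡n (≮⇒≥ k≮base))

  w≡ : ∀ i → ρ i + base i * p ≡ w i
  w≡ i = sym (m≡m%n+[m/n]*n (w i) p)

  sum-w : sum w ≡ sum ρ + sum base * p
  sum-w = trans (sum-cong-≗ (sym ∘ w≡)) (trans (∑-distrib-+ ρ (λ i → base i * p)) (cong (sum ρ +_) (sum-*ʳ base p)))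

  raise : Subset n → Vec ℕ n
  raise B = tabulate (λ i → base i + indicator (i ∈? B))

  lookup-raise : ∀ B i → lookup (raise B) i ≡ base i + indicator (i ∈? B)
  lookup-raise B = lookup∘tabulate (λ i → base i + indicator (i ∈? B))

  raise≤u : ∀ B → (∀ i → i ∈ˢ B → 0 < ρ i) → raise B InBox u
  raise≤u B supp i rewrite lookup-raise B i = *-cancelˡ-≤ p (bound (i ∈? B))
    where
    base*p≤ : p * base i ≤ w i
    base*p≤ = ≤-trans (≤-reflexive (*-comm p (base i))) (m/n*n≤m (w i) p)
    bound : (i∈? : Dec (i ∈ˢ B)) → p * (base i + indicator i∈?) ≤ p * u i
    bound (no _) = ≤-trans (≤-reflexive (cong (p *_) (+-identityʳ (base i)))) (≤-trans base*p≤ (w≤ i))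
    -- A positive remainder gives p · base i < w i ≤ p · u i, which leaves room for one more unit
    -- below the cap.
    bound (yes i∈) = *-monoʳ-≤ p (≤-trans (≤-reflexive (+-comm (base i) 1)) (*-cancelˡ-< p (base i) (u i)
      (<-≤-trans (≤-trans (+-monoˡ-≤ (p * base i) (supp i i∈))
        (≤-reflexive (trans (cong (ρ i +_) (*-comm p (base i))) (w≡ i)))) (w≤ i))))

  size-raise : ∀ B → ∣ B ∣ ≡ suc k′ → sum (lookup (raise B)) ≡ suc k
  size-raise B e = begin
    sum (lookup (raise B))                             ≡⟨ sum-cong-≗ (lookup-raise B) ⟩
    sum (λ i → base i + indicator (i ∈? B))            ≡⟨ ∑-distrib-+ base (λ i → indicator (i ∈? B)) ⟩
    sum base + sum (λ i → indicator (i ∈? B))          ≡⟨ cong (sum base +_) (trans (sym (∣∣≡sum B)) e) ⟩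
    sum base + suc k′                                  ≡⟨ +-suc (sum base) k′ ⟩
    suc (sum base + k′)                                ≡⟨ cong suc k≡ ⟨
    suc k                                              ∎
    where open ≡-Reasoning

  large : p * k′ + m * q < sum ρ
  large = +-cancelʳ-< (m + sum base * p) _ _ (subst₂ _<_ lhs rhs big)
    where
    expand : ∀ q m b k → suc q * (m + (b + k)) ≡ (suc q * k + m * q) + (m + b * suc q)
    expand = solve-∀
    lhs : p * (m + k) ≡ (p * k′ + m * q) + (m + sum base * p)
    lhs = trans (cong (λ x → p * (m + x)) k≡) (expand q m (sum base) k′)
    rhs : sum w + m ≡ sum ρ + (m + sum base * p)
    rhs = trans (cong (_+ m) sum-w) (trans (+-assoc (sum ρ) (sum base * p) m) (cong (sum ρ +_) (+-comm (sum base * p) m)))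

  open PrimeSets q pr n k′ m ρ (λ i → m%n<n (w i) p) (c ∘ raise)
    (λ B e supp → c<m (raise B) (raise≤u B supp) (size-raise B e)) using (Solution; solution)

  result : Monochromatic p k m u w c
  result with solution large
  ... | As , same , multiplicity = monochromatic (c (vs zero))
    (c<m (vs zero) (vs≤u zero) (vs-size zero))
    (List.tabulate vs) (length-tabulate vs)
    (All.tabulate⁺ (λ a → vs≤u a , vs-size a , proj₂ (same a)))
    λ i → begin
      total (List.tabulate vs) i                                  ≡⟨ total-tabulate vs i ⟩
      sum (λ a → lookup (vs a) i)                                 ≡⟨ sum-cong-≗ (λ a → lookup-raise (A a) i) ⟩
      sum (λ a → base i + indicator (i ∈? A a))                   ≡⟨ ∑-distrib-+ (λ _ → base i) (λ a → indicator (i ∈? A a)) ⟩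
      sum {p} (λ _ → base i) + sum (λ a → indicator (i ∈? A a))   ≡⟨ cong (_+ sum (λ a → indicator (i ∈? A a))) (sum-const p (base i)) ⟩
      p * base i + sum (λ a → indicator (i ∈? A a))               ≤⟨ +-monoʳ-≤ (p * base i) (multiplicity i) ⟩
      p * base i + ρ i                                            ≡⟨ trans (+-comm (p * base i) (ρ i)) (cong (ρ i +_) (*-comm p (base i))) ⟩
      ρ i + base i * p                                            ≡⟨ w≡ i ⟩
      w i                                                         ∎
    where
    open ≤-Reasoning
    A : Fin p → Subset n
    A = lookup As
    vs : Fin p → Vec ℕ n
    vs = raise ∘ A
    vs≤u : ∀ a → vs a InBox u
    vs≤u a = raise≤u (A a) λ i i∈ → ≤-trans (≤-reflexive (sym (indicator-true (i ∈? A a) i∈)))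
      (≤-trans (term≤sum (λ a → indicator (i ∈? A a)) a) (multiplicity i))
    vs-size : ∀ a → sum (lookup (vs a)) ≡ suc k
    vs-size a = size-raise (A a) (proj₁ (same a))

-- The general case and the return to sets

property : ∀ r → .{{NonZero r}} → Property r
property r = subst Property (sym isFactorisation) (all-products factors factorsPrime)
  where
  open PrimeFactorisation (factorise r)
  all-products : ∀ ps → All Prime ps → Property (product ps)
  all-products [] [] = property-1
  all-products (p@(suc _) ∷ ps) (pr ∷ prs) =
    property-* p (product ps) (property-prime p pr) (all-products ps prs)

-- Distinct positions pick distinct terms: the term at `ι zero` is removed and the remaining
-- positions are punched out around it.
injection≤sum : ∀ {s r} (ι : Fin s → Fin r) → Injective _≡_ _≡_ ι → (f : Fin r → ℕ) → (∀ j → 1 ≤ f (ι j)) → s ≤ sum f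
injection≤sum {zero} ι inj f pos = z≤n
injection≤sum {suc s} {zero} ι inj f pos with () ← ι zero
injection≤sum {suc s} {suc r} ι inj f pos = ≤-trans
  (+-mono-≤ (pos zero) (injection≤sum ι′ ι′-injective (f ∘ punchIn (ι zero))
    (λ j → ≤-trans (pos (suc j)) (≤-reflexive (cong f (sym (Fin.punchIn-punchOut (ι0≢ j))))))))
  (≤-reflexive (sym (sum-remove {i = ι zero} f)))
  where
  ι0≢ : ∀ j → ι zero ≢ ι (suc j)
  ι0≢ j e with () ← inj e
  ι′ : Fin s → Fin r
  ι′ j = punchOut (ι0≢ j)
  ι′-injective : Injective _≡_ _≡_ ι′
  ι′-injective {i} {j} e = Fin.suc-injective (inj (Fin.punchOut-injective (ι0≢ i) (ι0≢ j) e))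

support : Vec ℕ n → Subset n
support v = tabulate (λ i → does (0 <? lookup v i))

∈-support⁻ : ∀ (v : Vec ℕ n) i → i ∈ˢ support v → 1 ≤ lookup v i
∈-support⁻ v = ∈-tabulate⁻ (λ i → 0 <? lookup v i)

∣support∣ : ∀ (v : Vec ℕ n) → v InBox (λ _ → 1) → ∣ support v ∣ ≡ sum (lookup v)
∣support∣ v v≤1 = trans (∣tabulate∣ (λ i → 0 <? lookup v i)) (sum-cong-≗ λ i → zero-one (lookup v i) (v≤1 i))
  where
  zero-one : ∀ x → x ≤ 1 → indicator (0 <? x) ≡ x
  zero-one zero _ = refl
  zero-one (suc zero) _ = refl
  zero-one (suc (suc x)) (s≤s ())

-- Being below the ceiling of N / (r - 1) means m (r - 1) < N. This makes the truncated difference N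
-- positive, so it can be expanded as a true difference.
<colorBound⇒ : ∀ r s n k m → 2 ≤ r → m < colorBound r s n k → r * (m + (k ∸ 1)) < n * (s ∸ 1) + m
<colorBound⇒ r@(suc (suc d)) s n k m 2≤r m< =
  subst₂ _<_ (regroup d m (k ∸ 1)) (cong (_+ m) (*-comm (s ∸ 1) n))
    (+-monoˡ-< m (≰⇒> λ le → <⇒≱ below-numerator (m≤n+o⇒m∸n≤o _ (r * (k ∸ 1)) (≤-trans le (≤-reflexive (+-comm (m * suc d) _))))))
  where
  N = (s ∸ 1) * n ∸ r * (k ∸ 1)
  regroup : ∀ d m k → (m * suc d + suc (suc d) * k) + m ≡ suc (suc d) * (m + k)
  regroup = solve-∀
  below-numerator : m * suc d < N
  -- The cancelled `d` is the summand in `ceilDiv` that makes the quotient round up.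
  below-numerator = +-cancelʳ-≤ d _ _ (begin
    suc (m * suc d) + d        ≡⟨ rearrange m d ⟩
    suc m * suc d              ≤⟨ *-monoˡ-≤ (suc d) m< ⟩
    (N + d) / suc d * suc d    ≤⟨ m/n*n≤m (N + d) (suc d) ⟩
    N + d                      ∎)
    where
    open ≤-Reasoning
    rearrange : ∀ m d → suc (m * suc d) + d ≡ suc m * suc d
    rearrange = solve-∀

shifted≤primePower : ∀ ps → shiftedPowerProduct ps ≤ primePowerProduct ps
shifted≤primePower [] = ≤-refl
shifted≤primePower ((p , α) ∷ ps) = *-mono-≤ (^-monoˡ-≤ α (m∸n≤m p 1)) (shifted≤primePower ps)

theorem1p1 : (r k n s : ℕ) → 2 ≤ r → 1 ≤ k → s * k ≤ n →
    (α₀ : ℕ) (ps : List (ℕ × ℕ)) → OddPrimeFactorList ps →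
    r ≡ 2 ^ α₀ * primePowerProduct ps →
    2 ≤ s → s ≤ 2 ^ α₀ * shiftedPowerProduct ps →
    (m : ℕ) → m < colorBound r s n k →
    (c : (B : Subset n) → IsKSubset k B → Fin m) →
    Σ[ A ∈ (Fin r → Subset n) ] Σ[ h ∈ ((i : Fin r) → IsKSubset k (A i)) ] (((i j : Fin r) → c (A i) (h i) ≡ c (A j) (h j))
    × NoSWiseIntersection s A)
theorem1p1 r k@(suc k′) n s@(suc s′) 2≤r 1≤k sk≤n α₀ ps odd r≡ 2≤s s≤ m m< c =
  assemble vectors length≡ each total≤
  where
  s≤r : s ≤ r
  s≤r = ≤-trans s≤ (≤-trans (*-monoʳ-≤ (2 ^ α₀) (shifted≤primePower ps)) (≤-reflexive (sym r≡)))

  -- `c` expects a proof of the size, and sets of another size get the default 0; `≡-irrelevant`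
  -- makes the value independent of the proof.
  colourOf : ∀ B → Dec (∣ B ∣ ≡ k) → ℕ
  colourOf B (yes h) = toℕ (c B h)
  colourOf B (no _) = 0

  C : Vec ℕ n → ℕ
  C v = colourOf (support v) (∣ support v ∣ ≟ k)

  C≡ : ∀ v (h : ∣ support v ∣ ≡ k) → C v ≡ toℕ (c (support v) h)
  C≡ v h with ∣ support v ∣ ≟ k
  ... | yes h′ = cong (λ e → toℕ (c (support v) e)) (≡-irrelevant h′ h)
  ... | no ¬h = ⊥-elim (¬h h)

  C<m : ∀ v → v InBox (λ _ → 1) → sum (lookup v) ≡ k → C v < m
  C<m v v≤1 e = subst (_< m) (sym (C≡ v h)) (Fin.toℕ<n (c (support v) h))
    where h = trans (∣support∣ v v≤1) e

  -- Sets are the vectors below the cap 1, and the constant weight `s′`, that is s - 1, forbids a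
  -- point common to s of them. The cap condition becomes s - 1 ≤ r.
  open Monochromatic (property r ⦃ >-nonZero (<⇒≤ 2≤r) ⦄ k′ m (λ _ → 1) (λ _ → s′)
    (λ _ → ≤-trans (<⇒≤ s≤r) (≤-reflexive (sym (*-identityʳ r))))
    (subst (λ x → r * (m + k′) < x + m) (sym (sum-const n s′)) (<colorBound⇒ r s n k m 2≤r m<)) C C<m)

  -- `r` is generalized so that it can be replaced by `length L`.
  assemble : ∀ {r} L → length L ≡ r → All (λ v → v InBox (λ _ → 1) × sum (lookup v) ≡ k × C v ≡ colour) L →
    (∀ i → total L i ≤ s′) →
    Σ[ A ∈ (Fin r → Subset n) ] Σ[ h ∈ ((i : Fin r) → IsKSubset k (A i)) ] (((i j : Fin r) → c (A i) (h i) ≡ c (A j) (h j))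
    × NoSWiseIntersection s A)
  assemble L refl good le = A , A-size , A-colour , disjoint
    where
    A : Fin (length L) → Subset n
    A i = support (List.lookup L i)
    A-size : ∀ i → ∣ A i ∣ ≡ k
    A-size i = let v≤1 , e , _ = All.lookup good (∈-lookup i) in trans (∣support∣ (List.lookup L i) v≤1) e
    toℕ-colour : ∀ i → toℕ (c (A i) (A-size i)) ≡ colour
    toℕ-colour i = trans (sym (C≡ (List.lookup L i) (A-size i))) (proj₂ (proj₂ (All.lookup good (∈-lookup i))))
    A-colour : ∀ i j → c (A i) (A-size i) ≡ c (A j) (A-size j)
    A-colour i j = Fin.toℕ-injective (trans (toℕ-colour i) (sym (toℕ-colour j)))
    disjoint : NoSWiseIntersection s A
    disjoint ι ι-injective x with Fin.any? (λ j → ¬? (x ∈? A (ι j)))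
    ... | yes found = found
    -- Otherwise `x` lies in the sets at s distinct positions, and its total is at least s, above
    -- the bound `s′`.
    ... | no none = ⊥-elim (<-irrefl refl (≤-trans
      (injection≤sum ι ι-injective (λ i → lookup (List.lookup L i) x) λ j →
        ∈-support⁻ (List.lookup L (ι j)) x (decidable-stable (x ∈? A (ι j)) λ x∉ → none (j , x∉)))
      (≤-trans (≤-reflexive (sym (total-lookup L x))) (le x))))
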